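{- Let $D$ be a finite set and $P:D^2\to\{0,1\}$ a binary predicate such that for any two-element subsets $B,C\subseteq D$, the restriction $P|_{B\times C}$ is not a singleton. Then for every $0<\varepsilon<1$ and every instance $I$ of $\mathrm{CSP}(P)$ on $n$ variables there is an $\varepsilon$-sparsifier of $I$ with $O(\varepsilon^{ -2}n)$ constraints, where the implied constant does not depend on $I$, $n$ or $\varepsilon$.
   Context: A binary CSP instance is $I=(V,D,\Pi,w)$ where $V$ is a finite set of $n=|V|$ variables, $D$ a finite domain, $\Pi$ a set of constraints, each a pair $\langle (u,v),P\rangle$ with $u,v\in V$ distinct and $P:D^2\to\{0,1\}$, and $w:\Pi\to\mathbb{R}_{>0}$ positive weights. $\mathrm{CSP}(P)$ is the class of instances in which every constraint uses the predicate $P$. For an assignment $A:V\to D$, $\mathrm{Val}_I(A)=\sum_{\pi=\langle(u,v),P\rangle\in\Pi} w(\pi)P(A(u),A(v))$. For $0<\varepsilon<1$, an $\varepsilon$-sparsifier of $I$ is an instance $I_\varepsilon=(V,D,\Pi_\varepsilon,w_\varepsilon)$ with $\Pi_\varepsilon\subseteq\Pi$ and $w_\varepsilon:\Pi_\varepsilon\to\mathbb{R}_{>0}$ such that for every $A:V\to D$, $(1-\varepsilon)\mathrm{Val}_I(A)\le \mathrm{Val}_{I_\varepsilon}(A)\le(1+\varepsilon)\mathrm{Val}_I(A)$; its number of constraints is $|\Pi_\varepsilon|$. A predicate is a singleton if exactly one tuple is mapped to $1$. $P|_{B\times C}$ denotes the restriction of $P$ to $B\times C$. -}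

module Defs where

open import Data.Bool.Base using (Bool; true; if_then_else_)
open import Data.Fin.Base using (Fin)
open import Data.Fin.Subset using (Subset; _∈_)
open import Data.Integer.Base using (+_)
open import Data.Nat.Base as ℕ using (ℕ)
import Data.Nat.Properties as ℕₚ
open import Data.Product using (∃; ∃!; _×_; _,_; proj₁; proj₂)
open import Data.Rational.Base
  using (ℚ; 0ℚ; 1ℚ; ½; _+_; _*_; _-_; -_; ∣_∣; _/_; 1/_; _≤_; _<_;
         NonZero; Positive; positive; >-nonZero)
open import Data.Rational.Properties
open import Data.Rational.Solver using (module +-*-Solver)
open import Data.Vec.Functional using (Vector; foldr)
open import Function.Definitions using (Injective)
open import Relation.Binary.PropositionalEquality
  using (_≡_; _≢_; refl; sym; trans; cong; subst)

------------------------------------------------------------------------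
-- Real numbers, as Cauchy sequences of rationals

IsCauchy : (ℕ → ℚ) → Set
IsCauchy x = ∀ q → 0ℚ < q →
  ∃ λ N → ∀ m n → N ℕ.≤ m → N ℕ.≤ n → ∣ x m - x n ∣ < q

record ℝ : Set where
  constructor _,_
  field
    approx : ℕ → ℚ
    cauchy : IsCauchy approx

open ℝ public

-- Both relations respect equality of limits, so no quotient is needed:
-- x <ℝ y means that the sequences are eventually separated by a positive
-- rational, and x ≤ℝ y that x eventually exceeds y by no more than any given
-- positive rational.

infix 4 _<ℝ_ _≤ℝ_

_<ℝ_ : ℝ → ℝ → Set
x <ℝ y = ∃ λ q → 0ℚ < q ×
  (∃ λ N → ∀ n → N ℕ.≤ n → approx x n + q ≤ approx y n)

_≤ℝ_ : ℝ → ℝ → Set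
x ≤ℝ y = ∀ q → 0ℚ < q →
  ∃ λ N → ∀ n → N ℕ.≤ n → approx x n ≤ approx y n + q

private abstract
  half>0 : ∀ {q} → 0ℚ < q → 0ℚ < q * ½
  half>0 {q} q>0 = positive⁻¹ (q * ½) {{pos*pos⇒pos q {{positive q>0}} ½}}

  half+half : ∀ q → q * ½ + q * ½ ≡ q
  half+half q = trans (sym (*-distribˡ-+ q ½ ½)) (*-identityʳ q)

  bounded : ∀ {x} → IsCauchy x →
            ∃ λ K → 0ℚ < K × (∃ λ N → ∀ n → N ℕ.≤ n → ∣ x n ∣ < K)
  bounded {x} c with N , h ← c 1ℚ (positive⁻¹ 1ℚ) =
    1ℚ + ∣ x N ∣ ,
    positive⁻¹ (1ℚ + ∣ x N ∣)
      {{pos+nonNeg⇒pos 1ℚ ∣ x N ∣ {{∣-∣-nonNeg (x N)}}}} ,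
    N , λ n N≤n → begin-strict
      ∣ x n ∣                   ≡⟨ cong ∣_∣ (split (x n) (x N)) ⟩
      ∣ (x n - x N) + x N ∣     ≤⟨ ∣p+q∣≤∣p∣+∣q∣ (x n - x N) (x N) ⟩
      ∣ x n - x N ∣ + ∣ x N ∣   <⟨ +-monoˡ-< ∣ x N ∣ (h n N N≤n ℕₚ.≤-refl) ⟩
      1ℚ + ∣ x N ∣              ∎
    where
    open ≤-Reasoning
    open +-*-Solver
    split : ∀ a b → a ≡ (a - b) + b
    split = solve 2 (λ a b → a := (a :- b) :+ b) refl

  const-cauchy : ∀ p → IsCauchy (λ _ → p)
  const-cauchy p q q>0 =
    0 , λ _ _ _ _ → subst (λ r → ∣ r ∣ < q) (sym (+-inverseʳ p)) q>0

  +-cauchy : ∀ {x y} → IsCauchy x → IsCauchy y → IsCauchy (λ n → x n + y n)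
  +-cauchy {x} {y} cx cy q q>0
    with M , hx ← cx (q * ½) (half>0 q>0)
       | N , hy ← cy (q * ½) (half>0 q>0) =
    M ℕ.⊔ N , λ m n M⊔N≤m M⊔N≤n → begin-strict
      ∣ (x m + y m) - (x n + y n) ∣
        ≡⟨ cong ∣_∣ (regroup (x m) (y m) (x n) (y n)) ⟩
      ∣ (x m - x n) + (y m - y n) ∣
        ≤⟨ ∣p+q∣≤∣p∣+∣q∣ (x m - x n) (y m - y n) ⟩
      ∣ x m - x n ∣ + ∣ y m - y n ∣
        <⟨ +-mono-<
             (hx m n (ℕₚ.m⊔n≤o⇒m≤o M N M⊔N≤m) (ℕₚ.m⊔n≤o⇒m≤o M N M⊔N≤n))
             (hy m n (ℕₚ.m⊔n≤o⇒n≤o M N M⊔N≤m) (ℕₚ.m⊔n≤o⇒n≤o M N M⊔N≤n)) ⟩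
      q * ½ + q * ½
        ≡⟨ half+half q ⟩
      q ∎
    where
    open ≤-Reasoning
    open +-*-Solver
    regroup : ∀ a b c d → (a + b) - (c + d) ≡ (a - c) + (b - d)
    regroup = solve 4 (λ a b c d →
      (a :+ b) :- (c :+ d) := (a :- c) :+ (b :- d)) refl

  neg-cauchy : ∀ {x} → IsCauchy x → IsCauchy (λ n → - x n)
  neg-cauchy {x} cx q q>0 with N , h ← cx q q>0 =
    N , λ m n N≤m N≤n →
      subst (_< q)
        (trans (sym (∣-p∣≡∣p∣ (x m - x n)))
               (cong ∣_∣ (neg-distrib-+ (x m) (- x n))))
        (h m n N≤m N≤n)

  small-factor : ∀ {K q} → 0ℚ < K → 0ℚ < q →
    ∃ λ δ → 0ℚ < δ × (∀ a b → ∣ a ∣ < K → ∣ b ∣ < δ → ∣ a * b ∣ < q)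
  small-factor {K} {q} K>0 q>0 =
    q * 1/K ,
    positive⁻¹ (q * 1/K) {{pos*pos⇒pos q {{positive q>0}} 1/K {{1/pos⇒pos K}}}} ,
    λ a b a<K b<δ → begin-strict
      ∣ a * b ∣       ≡⟨ ∣p*q∣≡∣p∣*∣q∣ a b ⟩
      ∣ a ∣ * ∣ b ∣   ≤⟨ *-monoʳ-≤-nonNeg ∣ b ∣ {{∣-∣-nonNeg b}} (<⇒≤ a<K) ⟩
      K * ∣ b ∣       <⟨ *-monoʳ-<-pos K b<δ ⟩
      K * (q * 1/K)   ≡⟨ *-comm K (q * 1/K) ⟩
      (q * 1/K) * K   ≡⟨ *-assoc q 1/K K ⟩
      q * (1/K * K)   ≡⟨ cong (q *_) (*-inverseˡ K) ⟩
      q * 1ℚ          ≡⟨ *-identityʳ q ⟩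
      q               ∎
    where
    open ≤-Reasoning
    instance
      K-pos : Positive K
      K-pos = positive K>0
      K-nonZero : NonZero K
      K-nonZero = >-nonZero K>0
    1/K : ℚ
    1/K = 1/ K

  *-cauchy : ∀ {x y} → IsCauchy x → IsCauchy y → IsCauchy (λ n → x n * y n)
  *-cauchy {x} {y} cx cy q q>0 =
    -- Not by 'with', which would normalise the products of rationals.
    let K , K>0 , N₁ , x<K = bounded cx
        L , L>0 , N₂ , y<L = bounded cy
        δ , δ>0 , small-x = small-factor K>0 (half>0 q>0)
        η , η>0 , small-y = small-factor L>0 (half>0 q>0)
        N₃ , hx = cx η η>0
        N₄ , hy = cy δ δ>0
    in (N₁ ℕ.⊔ N₂) ℕ.⊔ (N₃ ℕ.⊔ N₄) , λ m n N≤m N≤n →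
      let N₁₂≤m = ℕₚ.m⊔n≤o⇒m≤o (N₁ ℕ.⊔ N₂) (N₃ ℕ.⊔ N₄) N≤m
          N₁₂≤n = ℕₚ.m⊔n≤o⇒m≤o (N₁ ℕ.⊔ N₂) (N₃ ℕ.⊔ N₄) N≤n
          N₃₄≤m = ℕₚ.m⊔n≤o⇒n≤o (N₁ ℕ.⊔ N₂) (N₃ ℕ.⊔ N₄) N≤m
          N₃₄≤n = ℕₚ.m⊔n≤o⇒n≤o (N₁ ℕ.⊔ N₂) (N₃ ℕ.⊔ N₄) N≤n
      in begin-strict
      ∣ x m * y m - x n * y n ∣
        ≡⟨ cong ∣_∣ (regroup (x m) (y m) (x n) (y n)) ⟩
      ∣ x m * (y m - y n) + y n * (x m - x n) ∣
        ≤⟨ ∣p+q∣≤∣p∣+∣q∣ (x m * (y m - y n)) (y n * (x m - x n)) ⟩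
      ∣ x m * (y m - y n) ∣ + ∣ y n * (x m - x n) ∣
        <⟨ +-mono-<
             (small-x (x m) (y m - y n)
               (x<K m (ℕₚ.m⊔n≤o⇒m≤o N₁ N₂ N₁₂≤m))
               (hy m n (ℕₚ.m⊔n≤o⇒n≤o N₃ N₄ N₃₄≤m) (ℕₚ.m⊔n≤o⇒n≤o N₃ N₄ N₃₄≤n)))
             (small-y (y n) (x m - x n)
               (y<L n (ℕₚ.m⊔n≤o⇒n≤o N₁ N₂ N₁₂≤n))
               (hx m n (ℕₚ.m⊔n≤o⇒m≤o N₃ N₄ N₃₄≤m) (ℕₚ.m⊔n≤o⇒m≤o N₃ N₄ N₃₄≤n))) ⟩
      q * ½ + q * ½
        ≡⟨ half+half q ⟩
      q ∎
    where
    open ≤-Reasoning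
    open +-*-Solver
    regroup : ∀ a b c d → a * b - c * d ≡ a * (b - d) + d * (a - c)
    regroup = solve 4 (λ a b c d →
      a :* b :- c :* d := a :* (b :- d) :+ d :* (a :- c)) refl

fromℚ : ℚ → ℝ
fromℚ p = (λ _ → p) , const-cauchy p

fromℕ : ℕ → ℝ
fromℕ n = fromℚ (+ n / 1)

0ℝ 1ℝ : ℝ
0ℝ = fromℚ 0ℚ
1ℝ = fromℚ 1ℚ

infixl 6 _+ℝ_ _-ℝ_
infixl 7 _*ℝ_
infix  8 -ℝ_

_+ℝ_ : ℝ → ℝ → ℝ
(x , cx) +ℝ (y , cy) = (λ n → x n + y n) , +-cauchy {x} {y} cx cy

-ℝ_ : ℝ → ℝ
-ℝ (x , cx) = (λ n → - x n) , neg-cauchy {x} cx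

_-ℝ_ : ℝ → ℝ → ℝ
x -ℝ y = x +ℝ -ℝ y

_*ℝ_ : ℝ → ℝ → ℝ
(x , cx) *ℝ (y , cy) = (λ n → x n * y n) , *-cauchy {x} {y} cx cy

sumℝ : ∀ {m} → Vector ℝ m → ℝ
sumℝ = foldr _+ℝ_ 0ℝ

------------------------------------------------------------------------
-- Binary CSPs with variable set V = Fin n and domain D = Fin d

Predicate : ℕ → Set
Predicate d = Fin d → Fin d → Bool

_≗₂_ : ∀ {d} → Predicate d → Predicate d → Set
P ≗₂ Q = ∀ a b → P a b ≡ Q a b

⟦_⟧ : Bool → ℝ
⟦ b ⟧ = if b then 1ℝ else 0ℝ

-- The restriction of P to B × C maps exactly one tuple to 1.
IsSingletonOn : ∀ {d} → Predicate d → Subset d → Subset d → Set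
IsSingletonOn P B C =
  ∃! _≡_ λ bc → proj₁ bc ∈ B × proj₂ bc ∈ C × P (proj₁ bc) (proj₂ bc) ≡ true

record Constraint (n d : ℕ) : Set where
  field
    u v  : Fin n
    u≢v  : u ≢ v
    pred : Predicate d

open Constraint public

-- Predicates are compared pointwise, as there is no function extensionality.
_≈_ : ∀ {n d} → Constraint n d → Constraint n d → Set
π ≈ ρ = u π ≡ u ρ × v π ≡ v ρ × pred π ≗₂ pred ρ

-- The constraint set Π is enumerated without repetition, so that
-- size = |Π|.
record Instance (n d : ℕ) : Set where
  field
    size       : ℕ
    constraint : Fin size → Constraint n d
    distinct   : Injective _≡_ _≈_ constraint
    weight     : Fin size → ℝ
    weight>0   : ∀ i → 0ℝ <ℝ weight i

open Instance public

InCSP : ∀ {n d} → Predicate d → Instance n d → Set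
InCSP P I = ∀ i → pred (constraint I i) ≗₂ P

_⊆_ : ∀ {n d} → Instance n d → Instance n d → Set
J ⊆ I = ∀ j → ∃ λ i → constraint J j ≈ constraint I i

Val : ∀ {n d} → Instance n d → (Fin n → Fin d) → ℝ
Val I A = sumℝ λ i →
  let π = constraint I i in weight I i *ℝ ⟦ pred π (A (u π)) (A (v π)) ⟧

record IsSparsifier {n d} (ε : ℝ) (I J : Instance n d) : Set where
  field
    subset : J ⊆ I
    lower  : ∀ A → (1ℝ -ℝ ε) *ℝ Val I A ≤ℝ Val J A
    upper  : ∀ A → Val J A ≤ℝ (1ℝ +ℝ ε) *ℝ Val I A

{-# OPTIONS --safe #-}
module Submission where

-- The hypothesis says that the zeros of P form disjoint combinatorial rectangles,
-- so P a b = [f a ≠ g b] for two labellings f, g of D by a set L of labels.  Hence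
-- Val is half the sum over c ∈ L of Σ w (x_u − y_v)², with x = [f(A) = c] and
-- y = [g(A) = c]: a sum of cut values in the bipartite double cover, which has 2n
-- vertices.  It therefore suffices to have a spectral sparsifier with O(ε⁻² n)
-- edges, and this is the Batson–Spielman–Srivastava barrier argument: reweighted
-- edges are added one at a time while the upper barrier u and the lower barrier l
-- move right, and averaging shows that some edge keeps both potentials
-- Tr M(uM − A)⁻¹ and Tr M(A − lM)⁻¹ bounded.
--
-- Quadratic forms are diagonal matrices acting on a subspace W of ℚ^E, the space
-- of potential differences along edges.  Gram–Schmidt yields inverses of forms on
-- W without square roots, so everything stays in ℚ, where the order is decidable;
-- the real weights and ε enter only through rational approximations with small
-- relative error.

open import Defs
open import Data.Nat.Base as ℕ using (ℕ; zero; suc)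
import Data.Nat.Properties as ℕₚ
import Data.Integer.Base as ℤ
import Data.Integer.Properties as ℤₚ
open import Data.Nat.Coprimality using (1-coprimeTo) renaming (sym to coprime-sym)
open import Data.Rational.Base
  using (ℚ; mkℚ; *≤*; 0ℚ; 1ℚ; _+_; _*_; _-_; -_; _/_; 1/_; _≤_; _<_; positive; nonNegative; >-nonZero)
  renaming (∣_∣ to ∣_∣ℚ)
open import Data.Rational.Properties
open import Data.Rational.Solver using (module +-*-Solver)
open import Data.Bool.Base using (Bool; true; false; if_then_else_)
open import Data.Maybe.Base as Maybe using (Maybe; just; nothing; maybe′)
open import Data.Fin.Base using (Fin; zero; suc; splitAt; _↑ˡ_)
import Data.Fin.Properties as Finₚ
open import Data.Fin.Subset using (Subset; ∣_∣; _∈_; _∉_; _∪_; ⁅_⁆; ⊥)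
open import Data.Fin.Subset.Properties
  using (_∈?_; ∉⊥; ∣⊥∣≡0; ∣⁅x⁆∣≡1; x∈⁅x⁆; x∈⁅y⁆⇒x≡y; x∈p∪q⁻; x∈p∪q⁺; ∪-identityˡ; ∪-identityʳ; drop-there)
open import Data.Vec.Base using ([]; _∷_; here; there)
open import Data.Vec.Functional using (Vector; _++_)
open import Data.Product using (∃; ∃-syntax; _×_; _,_; proj₁; proj₂)
open import Data.Sum.Base using (_⊎_; inj₁; inj₂)
open import Data.Sum.Properties using ([,]-map)
open import Data.Unit.Base using (⊤; tt)
open import Algebra.Bundles using (CommutativeRing)
open import Algebra.Properties.Semiring.Sum (CommutativeRing.semiring +-*-commutativeRing)
  using (sum; sum-cong-≗; ∑-distrib-+; *-distribˡ-sum; ∑-comm)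
open import Relation.Binary.Definitions using (tri<; tri≈; tri>)
open import Relation.Binary.PropositionalEquality
  using (_≡_; _≢_; _≗_; refl; sym; trans; cong; cong₂; subst; subst₂; module ≡-Reasoning)
open import Relation.Nullary using (¬_; yes; no; contradiction)
open +-*-Solver using (solve; _:=_; _:+_; _:*_; _:-_; :-_; con)

-- Ordered field lemmas and finite sums

-- The usual barrier argument follows eigenvalues. Here the statement that A lies between the
-- barriers is carried as positivity (`psd`) of the two inverted forms, and every estimate is a
-- trace identity for resolvents or an instance of Cauchy-Schwarz. M itself is the reference form,
-- so no vector is ever normalised by M^(-1/2). Averaging compares two numbers per edge: the
-- reciprocal of U(e) limits the weight that the upper barrier tolerates on e, and the reciprocal of
-- L(e) is the weight that the lower barrier requires. If both potentials are at most κ and the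
-- barriers move by d and 1, then Σ w U ≤ 1/d + κ and Σ w L ≥ 1 - κ. So some e has U(e) < L(e) once
-- 1/d + κ < 1 - κ, which d = 1 + 6κ satisfies for κ ≤ 1/12. The bound κ survives any number of
-- steps. It dictates where the barriers start, since at ±u the potential is at most N/u; the number
-- of steps is then chosen large enough for this offset to become a relative error κ. As W arises
-- from N = 2n incidence vectors and κ is of order ε, this takes O(n/ε²) steps.

0≤+ : ∀ {a b} → 0ℚ ≤ a → 0ℚ ≤ b → 0ℚ ≤ a + b
0≤+ = +-mono-≤

0≤* : ∀ {a b} → 0ℚ ≤ a → 0ℚ ≤ b → 0ℚ ≤ a * b
0≤* {a} {b} a≥0 b≥0 =
  nonNegative⁻¹ (a * b) {{nonNeg*nonNeg⇒nonNeg a {{nonNegative a≥0}} b {{nonNegative b≥0}}}}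

0<* : ∀ {a b} → 0ℚ < a → 0ℚ < b → 0ℚ < a * b
0<* {a} {b} a>0 b>0 = positive⁻¹ (a * b) {{pos*pos⇒pos a {{positive a>0}} b {{positive b>0}}}}

0<+ : ∀ {a b} → 0ℚ < a → 0ℚ ≤ b → 0ℚ < a + b
0<+ = +-mono-<-≤

0≤b-a : ∀ {a b} → a ≤ b → 0ℚ ≤ b - a
0≤b-a {a} {b} a≤b = subst (_≤ b - a) (+-inverseʳ a) (+-monoˡ-≤ (- a) a≤b)

0<b-a : ∀ {a b} → a < b → 0ℚ < b - a
0<b-a {a} {b} a<b = subst (_< b - a) (+-inverseʳ a) (+-monoˡ-< (- a) a<b)

≤-by : ∀ {a b} r → 0ℚ ≤ r → a + r ≡ b → a ≤ b
≤-by {a} {b} r r≥0 eq = subst₂ _≤_ (+-identityʳ a) eq (+-monoʳ-≤ a r≥0)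

<-by : ∀ {a b} r → 0ℚ < r → a + r ≡ b → a < b
<-by {a} {b} r r>0 eq = subst₂ _<_ (+-identityʳ a) eq (+-monoʳ-< a r>0)

0≤a² : ∀ a → 0ℚ ≤ a * a
0≤a² a with ≤-total 0ℚ a
... | inj₁ a≥0 = 0≤* a≥0 a≥0
... | inj₂ a≤0 = subst (0ℚ ≤_) (solve 1 (λ a → :- a :* :- a := a :* a) refl a)
                   (0≤* {(- a)} {(- a)} -a≥0 -a≥0)
  where
  -a≥0 : 0ℚ ≤ - a
  -a≥0 = subst (0ℚ ≤_) (+-identityˡ (- a)) (0≤b-a a≤0)

a²≤0⇒a≡0 : ∀ a → a * a ≤ 0ℚ → a ≡ 0ℚ
a²≤0⇒a≡0 a a²≤0 with a ≟ 0ℚ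
... | yes a≡0 = a≡0
... | no a≢0 with <-cmp 0ℚ a
...   | tri< a>0 _ _ = contradiction (<-≤-trans (0<* a>0 a>0) a²≤0) (<-irrefl refl)
...   | tri≈ _ 0≡a _ = sym 0≡a
...   | tri> _ _ a<0 = contradiction
  (<-≤-trans (0<* -a>0 -a>0) (≤-trans (≤-reflexive (solve 1 (λ a → :- a :* :- a := a :* a) refl a)) a²≤0))
  (<-irrefl refl)
  where
  -a>0 : 0ℚ < - a
  -a>0 = subst (0ℚ <_) (+-identityˡ (- a)) (0<b-a a<0)

reciprocal : ∀ {p} → 0ℚ < p → ∃ λ r → 0ℚ < r × p * r ≡ 1ℚ
reciprocal {p} p>0 = r , positive⁻¹ r {{1/pos⇒pos p {{positive p>0}}}} , *-inverseʳ p {{>-nonZero p>0}}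
  where
  r : ℚ
  r = (1/ p) {{>-nonZero p>0}}

*-cancelˡ-≤ : ∀ {p a b} → 0ℚ < p → p * a ≤ p * b → a ≤ b
*-cancelˡ-≤ {p} p>0 = *-cancelˡ-≤-pos p {{positive p>0}}

*-monoˡ-≤ : ∀ {p a b} → 0ℚ ≤ p → a ≤ b → p * a ≤ p * b
*-monoˡ-≤ {p} p≥0 = *-monoˡ-≤-nonNeg p {{nonNegative p≥0}}

-- A nonnegative binary quadratic form has nonpositive discriminant; homogeneity
-- makes the case c = 0 accessible without division.
b²≤ac : ∀ {a b c} → 0ℚ ≤ c → (∀ x y → 0ℚ ≤ x * x * a - (x * y * b + x * y * b) + y * y * c) → b * b ≤ a * c
b²≤ac {a} {b} {c} c≥0 form≥0 with <-cmp 0ℚ c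
... | tri< c>0 _ _ = *-cancelˡ-≤ c>0 (≤-by _ (form≥0 c b)
  (solve 3 (λ a b c → c :* (b :* b) :+ (c :* c :* a :- (c :* b :* b :+ c :* b :* b) :+ b :* b :* c)
    := c :* (a :* c)) refl a b c))
... | tri> _ _ c<0 = contradiction (≤-<-trans c≥0 c<0) (<-irrefl refl)
-- At c = 0 the form takes the value -b²(a + 2) at (b, a + 1), which forces b² ≤ 0.
... | tri≈ _ refl _ = ≤-trans
  (≤-by _ (0≤+ (form≥0 b (a + 1ℚ)) (0≤* (0≤a² b) a≥0))
     (solve 2 (λ a b → b :* b :+ ((b :* b :* a :- (b :* (a :+ con 1ℚ) :* b :+ b :* (a :+ con 1ℚ) :* b)
         :+ (a :+ con 1ℚ) :* (a :+ con 1ℚ) :* con 0ℚ) :+ b :* b :* a)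
       := :- (b :* b)) refl a b))
  (≤-by _ (0≤a² b) (solve 2 (λ a b → :- (b :* b) :+ b :* b := a :* con 0ℚ) refl a b))
  where
  a≥0 : 0ℚ ≤ a
  a≥0 = subst (0ℚ ≤_) (solve 2 (λ a b → con 1ℚ :* con 1ℚ :* a :- (con 1ℚ :* con 0ℚ :* b :+ con 1ℚ :* con 0ℚ :* b)
      :+ con 0ℚ :* con 0ℚ :* con 0ℚ := a) refl a b) (form≥0 1ℚ 0ℚ)

sum-mono : ∀ {m} {f g : Vector ℚ m} → (∀ i → f i ≤ g i) → sum f ≤ sum g
sum-mono {zero}  f≤g = ≤-refl
sum-mono {suc m} f≤g = +-mono-≤ (f≤g zero) (sum-mono (λ i → f≤g (suc i)))

sum-nonneg : ∀ {m} {f : Vector ℚ m} → (∀ i → 0ℚ ≤ f i) → 0ℚ ≤ sum f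
sum-nonneg {zero}  f≥0 = ≤-refl
sum-nonneg {suc m} f≥0 = 0≤+ (f≥0 zero) (sum-nonneg (λ i → f≥0 (suc i)))

term≤sum : ∀ {m} {f : Vector ℚ m} → (∀ i → 0ℚ ≤ f i) → ∀ i → f i ≤ sum f
term≤sum {f = f} f≥0 zero = ≤-by _ (sum-nonneg (λ i → f≥0 (suc i))) refl
term≤sum {f = f} f≥0 (suc i) = ≤-trans (term≤sum (λ i → f≥0 (suc i)) i)
  (≤-by _ (f≥0 zero) (+-comm _ (f zero)))

-- A linear search, possible because the order of ℚ is decidable. This is the averaging that selects
-- the next edge.
sum-<⇒∃ : ∀ {m} (f g : Vector ℚ m) → sum f < sum g → ∃ λ i → f i < g i
sum-<⇒∃ {zero}  f g 0<0 = contradiction 0<0 (<-irrefl refl)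
sum-<⇒∃ {suc m} f g f<g with f zero <? g zero
... | yes f₀<g₀ = zero , f₀<g₀
... | no f₀≮g₀ with sum-<⇒∃ (λ i → f (suc i)) (λ i → g (suc i)) tail<
  where
  tail< : sum (λ i → f (suc i)) < sum (λ i → g (suc i))
  tail< with sum (λ i → f (suc i)) <? sum (λ i → g (suc i))
  ... | yes lt = lt
  ... | no ≮ = contradiction (<-≤-trans f<g (+-mono-≤ (≮⇒≥ f₀≮g₀) (≮⇒≥ ≮))) (<-irrefl refl)
... | i , lt = suc i , lt

sum-zero : ∀ m → sum {m} (λ _ → 0ℚ) ≡ 0ℚ
sum-zero zero    = refl
sum-zero (suc m) = trans (+-identityˡ _) (sum-zero m)

δ : ∀ {m} → Fin m → Fin m → ℚ
δ zero    zero    = 1ℚ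
δ zero    (suc _) = 0ℚ
δ (suc _) zero    = 0ℚ
δ (suc i) (suc j) = δ i j

sum-δ : ∀ {m} (i : Fin m) (x : Vector ℚ m) → sum (λ j → δ i j * x j) ≡ x i
sum-δ {suc m} zero x = trans
  (cong₂ _+_ (*-identityˡ (x zero)) (trans (sum-cong-≗ (λ j → *-zeroˡ (x (suc j)))) (sum-zero m)))
  (+-identityʳ (x zero))
sum-δ {suc m} (suc i) x = trans
  (cong₂ _+_ (*-zeroˡ (x zero)) (sum-δ i (λ j → x (suc j))))
  (+-identityˡ (x (suc i)))

sum-comb : ∀ {m} a (f : Vector ℚ m) b g → sum (λ i → a * f i + b * g i) ≡ a * sum f + b * sum g
sum-comb a f b g = trans (∑-distrib-+ (λ i → a * f i) (λ i → b * g i))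
  (cong₂ _+_ (sym (*-distribˡ-sum a f)) (sym (*-distribˡ-sum b g)))

-- Diagonal forms and Gram-Schmidt

-- For edge weights `c` and potential differences `p`, `B c p p` is the Laplacian quadratic form.
B : ∀ {m} → Vector ℚ m → Vector ℚ m → Vector ℚ m → ℚ
B c p q = sum λ e → c e * (p e * q e)

comb : ∀ {m} → ℚ → Vector ℚ m → ℚ → Vector ℚ m → Vector ℚ m
comb a p b q e = a * p e + b * q e

B-cong : ∀ {m} {c c′ p p′ q q′ : Vector ℚ m} → c ≗ c′ → p ≗ p′ → q ≗ q′ → B c p q ≡ B c′ p′ q′
B-cong c≗ p≗ q≗ = sum-cong-≗ λ e → cong₂ _*_ (c≗ e) (cong₂ _*_ (p≗ e) (q≗ e))

B-comm : ∀ {m} (c p q : Vector ℚ m) → B c p q ≡ B c q p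
B-comm c p q = sum-cong-≗ λ e → cong (c e *_) (*-comm (p e) (q e))

B-combˡ : ∀ {m} (c : Vector ℚ m) a p b q r → B c (comb a p b q) r ≡ a * B c p r + b * B c q r
B-combˡ c a p b q r = trans
  (sum-cong-≗ λ e → solve 6 (λ a b c p q r → c :* ((a :* p :+ b :* q) :* r)
     := a :* (c :* (p :* r)) :+ b :* (c :* (q :* r))) refl a b (c e) (p e) (q e) (r e))
  (sum-comb a (λ e → c e * (p e * r e)) b (λ e → c e * (q e * r e)))

B-combʳ : ∀ {m} (c : Vector ℚ m) r a p b q → B c r (comb a p b q) ≡ a * B c r p + b * B c r q
B-combʳ c r a p b q = trans (B-comm c r (comb a p b q)) (trans (B-combˡ c a p b q r)
  (cong₂ (λ x y → a * x + b * y) (B-comm c p r) (B-comm c q r)))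

B-comb² : ∀ {m} (c : Vector ℚ m) a p b q → B c (comb a p b q) (comb a p b q)
  ≡ a * a * B c p p + (a * b * B c p q + a * b * B c p q) + b * b * B c q q
B-comb² c a p b q = begin
  B c (comb a p b q) (comb a p b q)
    ≡⟨ B-combˡ c a p b q (comb a p b q) ⟩
  a * B c p (comb a p b q) + b * B c q (comb a p b q)
    ≡⟨ cong₂ (λ x y → a * x + b * y) (B-combʳ c p a p b q) (B-combʳ c q a p b q) ⟩
  a * (a * B c p p + b * B c p q) + b * (a * B c q p + b * B c q q)
    ≡⟨ cong (λ x → a * (a * B c p p + b * B c p q) + b * (a * x + b * B c q q)) (B-comm c q p) ⟩
  a * (a * B c p p + b * B c p q) + b * (a * B c p q + b * B c q q)
    ≡⟨ solve 5 (λ a b x y z → a :* (a :* x :+ b :* y) :+ b :* (a :* y :+ b :* z)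
         := a :* a :* x :+ (a :* b :* y :+ a :* b :* y) :+ b :* b :* z)
         refl a b (B c p p) (B c p q) (B c q q) ⟩
  a * a * B c p p + (a * b * B c p q + a * b * B c p q) + b * b * B c q q ∎
  where open ≡-Reasoning

B-form : ∀ {m} a (c : Vector ℚ m) b c′ p q → B (comb a c b c′) p q ≡ a * B c p q + b * B c′ p q
B-form a c b c′ p q = trans
  (sum-cong-≗ λ e → solve 6 (λ a b c d p q → (a :* c :+ b :* d) :* (p :* q)
     := a :* (c :* (p :* q)) :+ b :* (d :* (p :* q))) refl a b (c e) (c′ e) (p e) (q e))
  (sum-comb a (λ e → c e * (p e * q e)) b (λ e → c′ e * (p e * q e)))

B-δ : ∀ {m} (g : Fin m) p q → B (δ g) p q ≡ p g * q g
B-δ g p q = sum-δ g (λ e → p e * q e)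

B-sumˡ : ∀ {m k} (c : Vector ℚ m) (a : Vector ℚ k) (P : Fin k → Vector ℚ m) r →
  B c (λ e → sum λ g → a g * P g e) r ≡ sum λ g → a g * B c (P g) r
B-sumˡ c a P r = begin
  sum (λ e → c e * (sum (λ g → a g * P g e) * r e))
    ≡⟨ sum-cong-≗ (λ e → trans (solve 3 (λ c s r → c :* (s :* r) := (c :* r) :* s) refl
         (c e) (sum (λ g → a g * P g e)) (r e)) (*-distribˡ-sum (c e * r e) (λ g → a g * P g e))) ⟩
  sum (λ e → sum (λ g → c e * r e * (a g * P g e)))
    ≡⟨ ∑-comm (λ e g → c e * r e * (a g * P g e)) ⟩
  sum (λ g → sum (λ e → c e * r e * (a g * P g e)))
    ≡⟨ sum-cong-≗ (λ g → trans
         (sum-cong-≗ λ e → solve 4 (λ c r a p → c :* r :* (a :* p) := a :* (c :* (p :* r))) refl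
            (c e) (r e) (a g) (P g e))
         (sym (*-distribˡ-sum (a g) (λ e → c e * (P g e * r e))))) ⟩
  sum (λ g → a g * B c (P g) r) ∎
  where open ≡-Reasoning

B-nonneg : ∀ {m} {c : Vector ℚ m} → (∀ e → 0ℚ ≤ c e) → ∀ p → 0ℚ ≤ B c p p
B-nonneg c≥0 p = sum-nonneg λ e → 0≤* (c≥0 e) (0≤a² (p e))

B-definite : ∀ {m} {c : Vector ℚ m} → (∀ e → 0ℚ < c e) → ∀ p → B c p p ≤ 0ℚ → ∀ e → p e ≡ 0ℚ
B-definite {c = c} c>0 p Bpp≤0 e = a²≤0⇒a≡0 (p e) (*-cancelˡ-≤ (c>0 e) (begin
  c e * (p e * p e)  ≤⟨ term≤sum (λ f → 0≤* (<⇒≤ (c>0 f)) (0≤a² (p f))) e ⟩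
  B c p p            ≤⟨ Bpp≤0 ⟩
  0ℚ                 ≡⟨ *-zeroʳ (c e) ⟨
  c e * 0ℚ           ∎))
  where open ≤-Reasoning

-- Defined by recursion for the sake of induction; numerals such as `ι 12` still compute as
-- constants of the ring solver.
ι : ℕ → ℚ
ι zero    = 0ℚ
ι (suc n) = ι n + 1ℚ

record IsSubspace {m} (W : Vector ℚ m → Set) : Set where
  field
    W-resp : ∀ {p q} → p ≗ q → W p → W q
    W-comb : ∀ a {p} b {q} → W p → W q → W (comb a p b q)
    W-sum  : ∀ {k} (a : Vector ℚ k) {P : Fin k → Vector ℚ m} → (∀ g → W (P g)) →
             W (λ e → sum λ g → a g * P g e)

Kernel : ℕ → Set
Kernel m = Fin m → Vector ℚ m

-- In matrix terms GCp = p. This expresses both that p lies in the range of a projection GC and that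
-- G inverts C at p.
Fixes : ∀ {m} → Vector ℚ m → Kernel m → Vector ℚ m → Set
Fixes c G p = ∀ f → B c (G f) p ≡ p f

-- Tr(GC). For a projection GC this is its rank, so bounding it replaces a theory of dimension; for
-- an inverse of another form it is a barrier potential.
trace : ∀ {m} → Vector ℚ m → Kernel m → ℚ
trace c G = sum λ e → c e * G e e

Fixes-sum : ∀ {m k} (c : Vector ℚ m) G (a : Vector ℚ k) {P : Fin k → Vector ℚ m} → (∀ g → Fixes c G (P g)) →
  Fixes c G (λ e → sum λ g → a g * P g e)
Fixes-sum c G a {P} fix f = begin
  B c (G f) (λ e → sum λ g → a g * P g e)   ≡⟨ B-comm c (G f) _ ⟩
  B c (λ e → sum λ g → a g * P g e) (G f)   ≡⟨ B-sumˡ c a P (G f) ⟩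
  sum (λ g → a g * B c (P g) (G f))         ≡⟨ sum-cong-≗ (λ g → cong (a g *_) (trans (B-comm c (P g) (G f)) (fix g f))) ⟩
  sum (λ g → a g * P g f)                   ∎
  where open ≡-Reasoning

Fixes-subspace : ∀ {m} (c : Vector ℚ m) G → IsSubspace (Fixes c G)
Fixes-subspace c G = record
  { W-resp = λ p≗q fix f → trans (sym (B-cong {c = c} {p = G f} (λ _ → refl) (λ _ → refl) p≗q)) (trans (fix f) (p≗q f))
  ; W-comb = λ a {p} b {q} fp fq f → trans (B-combʳ c (G f) a p b q) (cong₂ (λ x y → a * x + b * y) (fp f) (fq f))
  ; W-sum  = λ a {P} fP → Fixes-sum c G a {P} fP
  }

module _ {m} {W : Vector ℚ m → Set} (W-sub : IsSubspace W) where
  open IsSubspace W-sub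

  -- G C is the c-orthogonal projection onto the row space of G, where C = diag c.
  record IsProjection (c : Vector ℚ m) (G : Kernel m) : Set where
    field
      symm : ∀ e f → G e f ≡ G f e
      mem  : ∀ f → W (G f)
      idem : ∀ f → Fixes c G (G f)

  record Extension (c : Vector ℚ m) (G : Kernel m) (N : ℕ) (b : Fin N → Vector ℚ m) : Set where
    field
      kernel     : Kernel m
      projection : IsProjection c kernel
      keeps      : ∀ p → Fixes c G p → Fixes c kernel p
      fixes      : ∀ i → Fixes c kernel (b i)
      trace≤     : trace c kernel ≤ trace c G + ι N

  module _ {c : Vector ℚ m} (definite : ∀ p → W p → B c p p ≤ 0ℚ → ∀ e → p e ≡ 0ℚ) where

    module _ {G : Kernel m} (proj : IsProjection c G) {v : Vector ℚ m} (v∈W : W v) where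
      open IsProjection proj

      private
        image residual : Vector ℚ m
        image e = B c (G e) v
        residual = comb 1ℚ v (- 1ℚ) image

        image-comb : (λ e → sum λ g → c g * v g * G g e) ≗ image
        image-comb e = sum-cong-≗ λ g → trans (cong (c g * v g *_) (symm g e))
          (solve 3 (λ c v x → c :* v :* x := c :* (x :* v)) refl (c g) (v g) (G e g))

        image∈W : W image
        image∈W = W-resp image-comb (W-sum (λ g → c g * v g) mem)

        residual∈W : W residual
        residual∈W = W-comb 1ℚ (- 1ℚ) v∈W image∈W

        image-fixed : Fixes c G image
        image-fixed = IsSubspace.W-resp (Fixes-subspace c G) image-comb
          (Fixes-sum c G (λ g → c g * v g) {G} idem)

        residual⊥G : ∀ f → B c (G f) residual ≡ 0ℚ
        residual⊥G f = begin
          B c (G f) residual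
            ≡⟨ B-combʳ c (G f) 1ℚ v (- 1ℚ) image ⟩
          1ℚ * B c (G f) v + (- 1ℚ) * B c (G f) image
            ≡⟨ cong (λ x → 1ℚ * B c (G f) v + (- 1ℚ) * x) (image-fixed f) ⟩
          1ℚ * B c (G f) v + (- 1ℚ) * B c (G f) v
            ≡⟨ solve 1 (λ x → con 1ℚ :* x :+ con (- 1ℚ) :* x := con 0ℚ) refl (B c (G f) v) ⟩
          0ℚ ∎
          where open ≡-Reasoning

        residual⊥fixed : ∀ p → Fixes c G p → B c residual p ≡ 0ℚ
        residual⊥fixed p fix = begin
          B c residual p
            ≡⟨ B-comm c residual p ⟩
          B c p residual
            ≡⟨ B-cong {c = c} {p′ = λ e → sum λ g → c g * p g * G g e} {q = residual} (λ _ → refl)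
                 (λ e → trans (sym (fix e)) (sum-cong-≗ λ g → trans
                    (solve 3 (λ c v x → c :* (x :* v) := c :* v :* x) refl (c g) (p g) (G e g))
                    (cong (c g * p g *_) (symm e g)))) (λ _ → refl) ⟩
          B c (λ e → sum λ g → c g * p g * G g e) residual
            ≡⟨ B-sumˡ c (λ g → c g * p g) G residual ⟩
          sum (λ g → c g * p g * B c (G g) residual)
            ≡⟨ sum-cong-≗ (λ g → trans (cong (c g * p g *_) (residual⊥G g)) (*-zeroʳ (c g * p g))) ⟩
          sum (λ (g : Fin m) → 0ℚ)
            ≡⟨ sum-zero m ⟩
          0ℚ ∎
          where open ≡-Reasoning

        split-v : ∀ f → v f ≡ image f + residual f
        split-v f = solve 2 (λ v i → v := i :+ (con 1ℚ :* v :+ con (- 1ℚ) :* i)) refl (v f) (image f)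

      -- A Gram-Schmidt step without normalisation: the kernel gains r rᵀ / (rᵀCr) for the residual
      -- r, which adds 1 to the trace. If rᵀCr ≤ 0, definiteness gives r = 0, and `v` was fixed
      -- already.
      extend : Extension c G 1 (λ _ → v)
      extend with B c residual residual ≤? 0ℚ
      ... | yes ρ≤0 = record
        { kernel = G ; projection = proj ; keeps = λ _ fix → fix
        ; fixes = λ _ f → sym (trans (split-v f) (trans (cong (image f +_) (definite residual residual∈W ρ≤0 f))
                               (+-identityʳ (image f))))
        ; trace≤ = ≤-by 1ℚ (<⇒≤ (positive⁻¹ 1ℚ)) refl }
      ... | no ρ≰0 = record
        { kernel = G′
        ; projection = record
          { symm = λ e f → cong₂ _+_ (cong (1ℚ *_) (symm e f))
              (solve 3 (λ k x y → k :* x :* y := k :* y :* x) refl κ (residual e) (residual f))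
          ; mem = λ f → W-comb 1ℚ (κ * residual f) (mem f) residual∈W
          ; idem = λ f → IsSubspace.W-comb (Fixes-subspace c G′) 1ℚ {G f} (κ * residual f) {residual}
              (keeps′ (G f) (idem f)) fixes-residual }
        ; keeps = keeps′
        ; fixes = λ _ → IsSubspace.W-resp (Fixes-subspace c G′) (λ f → trans
              (cong₂ _+_ (*-identityˡ (image f)) (*-identityˡ (residual f))) (sym (split-v f)))
            (IsSubspace.W-comb (Fixes-subspace c G′) 1ℚ {image} 1ℚ {residual} (keeps′ image image-fixed) fixes-residual)
        ; trace≤ = ≤-reflexive trace′ }
        where
        open ≡-Reasoning
        ρ κ : ℚ
        ρ = B c residual residual
        ρ>0 : 0ℚ < ρ
        ρ>0 = ≰⇒> ρ≰0
        κ = proj₁ (reciprocal ρ>0)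
        ρκ≡1 : ρ * κ ≡ 1ℚ
        ρκ≡1 = proj₂ (proj₂ (reciprocal ρ>0))
        G′ : Kernel m
        G′ f = comb 1ℚ (G f) (κ * residual f) residual
        keeps′ : ∀ p → Fixes c G p → Fixes c G′ p
        keeps′ p fix f = begin
          B c (G′ f) p
            ≡⟨ B-combˡ c 1ℚ (G f) (κ * residual f) residual p ⟩
          1ℚ * B c (G f) p + κ * residual f * B c residual p
            ≡⟨ cong₂ (λ x y → 1ℚ * x + κ * residual f * y) (fix f) (residual⊥fixed p fix) ⟩
          1ℚ * p f + κ * residual f * 0ℚ
            ≡⟨ solve 2 (λ x y → con 1ℚ :* x :+ y :* con 0ℚ := x) refl (p f) (κ * residual f) ⟩
          p f ∎
        fixes-residual : Fixes c G′ residual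
        fixes-residual f = begin
          B c (G′ f) residual
            ≡⟨ B-combˡ c 1ℚ (G f) (κ * residual f) residual residual ⟩
          1ℚ * B c (G f) residual + κ * residual f * ρ
            ≡⟨ cong (λ x → 1ℚ * x + κ * residual f * ρ) (residual⊥G f) ⟩
          1ℚ * 0ℚ + κ * residual f * ρ
            ≡⟨ solve 3 (λ k r ρ → con 1ℚ :* con 0ℚ :+ k :* r :* ρ := ρ :* k :* r) refl κ (residual f) ρ ⟩
          ρ * κ * residual f
            ≡⟨ cong (_* residual f) ρκ≡1 ⟩
          1ℚ * residual f
            ≡⟨ *-identityˡ (residual f) ⟩
          residual f ∎
        trace′ : trace c G′ ≡ trace c G + (0ℚ + 1ℚ)
        trace′ = begin
          sum (λ e → c e * G′ e e)
            ≡⟨ sum-cong-≗ (λ e → solve 4 (λ c g k r → c :* (con 1ℚ :* g :+ k :* r :* r)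
                 := con 1ℚ :* (c :* g) :+ k :* (c :* (r :* r))) refl (c e) (G e e) κ (residual e)) ⟩
          sum (λ e → 1ℚ * (c e * G e e) + κ * (c e * (residual e * residual e)))
            ≡⟨ sum-comb 1ℚ (λ e → c e * G e e) κ (λ e → c e * (residual e * residual e)) ⟩
          1ℚ * trace c G + κ * ρ
            ≡⟨ cong₂ _+_ (*-identityˡ (trace c G)) (trans (*-comm κ ρ) ρκ≡1) ⟩
          trace c G + 1ℚ ∎

    gramSchmidt : ∀ {G} → IsProjection c G → ∀ {N} (b : Fin N → Vector ℚ m) → (∀ i → W (b i)) → Extension c G N b
    gramSchmidt {G} proj {zero} b b∈W = record
      { kernel = G ; projection = proj ; keeps = λ _ fix → fix ; fixes = λ ()
      ; trace≤ = ≤-reflexive (sym (+-identityʳ (trace c G))) }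
    gramSchmidt {G} proj {suc N} b b∈W = record
      { kernel = E.kernel
      ; projection = E.projection
      ; keeps = λ p fix → E.keeps p (E₀.keeps p fix)
      ; fixes = λ { zero → E.keeps (b zero) (E₀.fixes zero) ; (suc i) → E.fixes i }
      ; trace≤ = begin
          trace c E.kernel                ≤⟨ E.trace≤ ⟩
          trace c E₀.kernel + ι N         ≤⟨ +-monoˡ-≤ (ι N) E₀.trace≤ ⟩
          trace c G + (0ℚ + 1ℚ) + ι N     ≡⟨ solve 2 (λ t n → t :+ (con 0ℚ :+ con 1ℚ) :+ n := t :+ (n :+ con 1ℚ)) refl (trace c G) (ι N) ⟩
          trace c G + (ι N + 1ℚ)          ∎ }
      where
      open ≤-Reasoning
      module E₀ = Extension (extend proj (b∈W zero))
      module E = Extension (gramSchmidt E₀.projection (λ i → b (suc i)) (λ i → b∈W (suc i)))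

    zeroProjection : IsProjection c (λ _ _ → 0ℚ)
    zeroProjection = record
      { symm = λ _ _ → refl
      ; mem  = λ _ → W-sum {k = 0} (λ ()) {λ ()} (λ ())
      ; idem = λ _ _ → trans (sum-cong-≗ λ e → solve 1 (λ c → c :* (con 0ℚ :* con 0ℚ) := con 0ℚ) refl (c e)) (sum-zero m) }

-- Inverses of forms on a subspace

module Inverses {m} {w : Vector ℚ m} (w>0 : ∀ e → 0ℚ < w e)
  {W : Vector ℚ m → Set} (W-sub : IsSubspace W) where
  open IsSubspace W-sub

  -- G is the inverse of the quadratic form C = diag c on W, that is, GC is the
  -- identity on W.
  record Inverse (c : Vector ℚ m) (G : Kernel m) : Set where
    field
      mem : ∀ f → W (G f)
      rep : ∀ p → W p → Fixes c G p
      psd : ∀ p → W p → 0ℚ ≤ B c p p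

    symm : ∀ e f → G e f ≡ G f e
    symm e f = begin
      G e f             ≡⟨ rep (G e) (mem e) f ⟨
      B c (G f) (G e)   ≡⟨ B-comm c (G f) (G e) ⟩
      B c (G e) (G f)   ≡⟨ rep (G f) (mem f) e ⟩
      G f e             ∎
      where open ≡-Reasoning

    diagonal≥0 : ∀ f → 0ℚ ≤ G f f
    diagonal≥0 f = subst (0ℚ ≤_) (rep (G f) (mem f) f) (psd (G f) (mem f))

    -- The value `p f` is the product of `p` with the row `G f` in the form `c`, and `G f f` is the
    -- square of that row.
    cauchySchwarz : ∀ {p} → W p → ∀ f → p f * p f ≤ B c p p * G f f
    cauchySchwarz {p} p∈W f = b²≤ac (diagonal≥0 f) λ x y → subst (0ℚ ≤_)
      (trans (B-comb² c x p (- y) (G f)) (trans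
        (cong₂ (λ b g → x * x * B c p p + (x * - y * b + x * - y * b) + - y * - y * g)
          (trans (B-comm c p (G f)) (rep p p∈W f)) (rep (G f) (mem f) f))
        (solve 5 (λ x y a b g → x :* x :* a :+ (x :* :- y :* b :+ x :* :- y :* b) :+ :- y :* :- y :* g
           := x :* x :* a :- (x :* y :* b :+ x :* y :* b) :+ y :* y :* g) refl x y (B c p p) (p f) (G f f))))
      (psd (comb x p (- y) (G f)) (W-comb x (- y) p∈W (mem f)))

    definite : ∀ p → W p → B c p p ≤ 0ℚ → ∀ f → p f ≡ 0ℚ
    definite p p∈W Bpp≤0 f = a²≤0⇒a≡0 (p f) (≤-trans (cauchySchwarz p∈W f)
      (≤-trans (*-monoʳ-≤-nonNeg (G f f) {{nonNegative (diagonal≥0 f)}} Bpp≤0) (≤-reflexive (*-zeroˡ (G f f)))))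

    -- Cauchy-Schwarz summed over the edges gives M ≤ Tr(GM) C on W. Hence C - M remains positive
    -- while the potential is below 1, which is what lets the lower barrier move by 1.
    bound : ∀ p → W p → B w p p ≤ B c p p * trace w G
    bound p p∈W = begin
      sum (λ f → w f * (p f * p f))
        ≤⟨ sum-mono (λ f → *-monoˡ-≤ (<⇒≤ (w>0 f)) (cauchySchwarz p∈W f)) ⟩
      sum (λ f → w f * (B c p p * G f f))
        ≡⟨ sum-cong-≗ (λ f → solve 3 (λ w b g → w :* (b :* g) := b :* (w :* g)) refl (w f) (B c p p) (G f f)) ⟩
      sum (λ f → B c p p * (w f * G f f))
        ≡⟨ *-distribˡ-sum (B c p p) (λ f → w f * G f f) ⟨
      B c p p * trace w G ∎
      where open ≤-Reasoning

    image : Vector ℚ m → Vector ℚ m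
    image q e = B w (G e) q

    private
      image-comb : ∀ q → (λ e → sum λ g → w g * q g * G g e) ≗ image q
      image-comb q e = sum-cong-≗ λ g → trans (cong (w g * q g *_) (symm g e))
        (solve 3 (λ c v x → c :* v :* x := c :* (x :* v)) refl (w g) (q g) (G e g))

    image∈W : ∀ q → W (image q)
    image∈W q = W-resp (image-comb q) (W-sum (λ g → w g * q g) mem)

    -- `image q` is GMq. Since GC is the identity on W, CG acts as the identity when tested against
    -- W.
    image-adjoint : ∀ q p → W p → B c (image q) p ≡ B w q p
    image-adjoint q p p∈W = begin
      B c (image q) p
        ≡⟨ B-cong {c = c} {q = p} (λ _ → refl) (image-comb q) (λ _ → refl) ⟨
      B c (λ e → sum λ g → w g * q g * G g e) p
        ≡⟨ B-sumˡ c (λ g → w g * q g) G p ⟩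
      sum (λ g → w g * q g * B c (G g) p)
        ≡⟨ sum-cong-≗ (λ g → trans (cong (w g * q g *_) (rep p p∈W g)) (*-assoc (w g) (q g) (p g))) ⟩
      B w q p ∎
      where open ≡-Reasoning

    image≥0 : ∀ q → 0ℚ ≤ B w q (image q)
    image≥0 q = subst (0ℚ ≤_) (image-adjoint q (image q) (image∈W q)) (psd (image q) (image∈W q))

  Inverse-resp : ∀ {c c′ G} → c ≗ c′ → Inverse c G → Inverse c′ G
  Inverse-resp {c} {c′} {G} c≗c′ inv = record
    { mem = mem
    ; rep = λ p p∈W f → trans (sym (B-cong {p = G f} {q = p} c≗c′ (λ _ → refl) (λ _ → refl))) (rep p p∈W f)
    ; psd = λ p p∈W → subst (0ℚ ≤_) (B-cong {p = p} {q = p} c≗c′ (λ _ → refl) (λ _ → refl)) (psd p p∈W) }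
    where open Inverse inv

  Inverse-scale : ∀ {c G} a b → 0ℚ ≤ a → a * b ≡ 1ℚ → Inverse c G →
    Inverse (λ e → a * c e) (λ e f → b * G e f)
  Inverse-scale {c} {G} a b a≥0 ab≡1 inv = record
    { mem = λ f → W-resp (λ e → solve 2 (λ b g → b :* g :+ con 0ℚ :* g := b :* g) refl b (G f e))
                    (W-comb b 0ℚ (mem f) (mem f))
    ; rep = λ p p∈W f → begin
        sum (λ e → a * c e * (b * G f e * p e))
          ≡⟨ sum-cong-≗ (λ e → trans (solve 5 (λ a b c g p → a :* c :* (b :* g :* p) := a :* b :* (c :* (g :* p)))
               refl a b (c e) (G f e) (p e)) (trans (cong (_* (c e * (G f e * p e))) ab≡1) (*-identityˡ (c e * (G f e * p e))))) ⟩
        B c (G f) p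
          ≡⟨ rep p p∈W f ⟩
        p f ∎
    ; psd = λ p p∈W → subst (0ℚ ≤_) (trans (*-distribˡ-sum a (λ e → c e * (p e * p e)))
                (sum-cong-≗ λ e → sym (*-assoc a (c e) (p e * p e)))) (0≤* a≥0 (psd p p∈W)) }
    where
    open Inverse inv
    open ≡-Reasoning

  -- Every p in W is the combination Σ w_g p_g G_g of the rows of the inverse of `w`. So these rows
  -- generate W, and Gram-Schmidt with respect to `c` on them yields a kernel that fixes all of W.
  Inverse-exists : ∀ {c G} → Inverse w G → (∀ p → W p → 0ℚ ≤ B c p p) →
    (∀ p → W p → B c p p ≤ 0ℚ → ∀ e → p e ≡ 0ℚ) → ∃ (Inverse c)
  Inverse-exists {c} {G} inv nonneg definite = kernel , record
    { mem = IsProjection.mem projection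
    ; rep = λ p p∈W → IsSubspace.W-resp (Fixes-subspace c kernel)
        (λ e → trans (sum-cong-≗ λ g → trans (cong (w g * p g *_) (symm g e))
           (solve 3 (λ c v x → c :* v :* x := c :* (x :* v)) refl (w g) (p g) (G e g))) (rep p p∈W e))
        (Fixes-sum c kernel (λ g → w g * p g) {G} fixes)
    ; psd = nonneg }
    where
    open Inverse inv using (mem; rep; symm)
    open Extension (gramSchmidt W-sub {c} definite (zeroProjection W-sub {c} definite) G mem)

  -- Tr(GMHM) for M = diag w, just as trace w G is the potential Tr(GM).
  ⟨_,_⟩ : Kernel m → Kernel m → ℚ
  ⟨ G , H ⟩ = sum λ f → w f * B w (G f) (H f)

  module _ {c G H d} (d≥0 : 0ℚ ≤ d) (invG : Inverse c G) (invH : Inverse (comb 1ℚ c d w) H) where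
    private
      module G = Inverse invG
      module H = Inverse invH

    -- The resolvent identity G = H + d GMH, obtained by evaluating the shifted form on the rows
    -- `G e` and `H f` in two ways.
    resolvent : ∀ e f → G e f ≡ H e f + d * B w (G e) (H f)
    resolvent e f = begin
      G e f
        ≡⟨ H.rep (G e) (G.mem e) f ⟨
      B (comb 1ℚ c d w) (H f) (G e)
        ≡⟨ B-comm (comb 1ℚ c d w) (H f) (G e) ⟩
      B (comb 1ℚ c d w) (G e) (H f)
        ≡⟨ B-form 1ℚ c d w (G e) (H f) ⟩
      1ℚ * B c (G e) (H f) + d * B w (G e) (H f)
        ≡⟨ cong (_+ d * B w (G e) (H f)) (trans (*-identityˡ (B c (G e) (H f))) (trans (G.rep (H f) (H.mem f) e) (H.symm f e))) ⟩
      H e f + d * B w (G e) (H f) ∎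
      where open ≡-Reasoning

    trace-resolvent : trace w G ≡ trace w H + d * ⟨ G , H ⟩
    trace-resolvent = begin
      sum (λ f → w f * G f f)
        ≡⟨ sum-cong-≗ (λ f → trans (cong (w f *_) (resolvent f f))
             (solve 4 (λ w h d b → w :* (h :+ d :* b) := con 1ℚ :* (w :* h) :+ d :* (w :* b))
               refl (w f) (H f f) d (B w (G f) (H f)))) ⟩
      sum (λ f → 1ℚ * (w f * H f f) + d * (w f * B w (G f) (H f)))
        ≡⟨ sum-comb 1ℚ (λ f → w f * H f f) d (λ f → w f * B w (G f) (H f)) ⟩
      1ℚ * trace w H + d * ⟨ G , H ⟩
        ≡⟨ cong (_+ d * ⟨ G , H ⟩) (*-identityˡ (trace w H)) ⟩
      trace w H + d * ⟨ G , H ⟩ ∎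
      where open ≡-Reasoning

    private
      -- Row by row G = H + d GMH; `G-via-H` is the transposed identity G = H + d HMG.
      G-via-G : ∀ f → G f ≗ comb 1ℚ (H f) d (G.image (H f))
      G-via-G f e = trans (G.symm f e) (trans (resolvent e f)
        (cong (_+ d * B w (G e) (H f)) (trans (H.symm e f) (sym (*-identityˡ (H f e))))))

      G-via-H : ∀ f → G f ≗ comb 1ℚ (H f) d (H.image (G f))
      G-via-H f e = trans (resolvent f e)
        (cong₂ _+_ (sym (*-identityˡ (H f e))) (cong (d *_) (B-comm w (G f) (H e))))

    -- Substituting G = H + d GMH, the difference of the two sides is d Tr(HMGMHM), a sum of
    -- nonnegative terms.
    square≤cross : ⟨ H , H ⟩ ≤ ⟨ G , H ⟩
    square≤cross = sum-mono λ f → *-monoˡ-≤ (<⇒≤ (w>0 f)) (≤-by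
      (d * B w (H f) (G.image (H f))) (0≤* d≥0 (G.image≥0 (H f))) (sym (begin
        B w (G f) (H f)
          ≡⟨ B-cong {c = w} {q = H f} (λ _ → refl) (G-via-G f) (λ _ → refl) ⟩
        B w (comb 1ℚ (H f) d (G.image (H f))) (H f)
          ≡⟨ B-combˡ w 1ℚ (H f) d (G.image (H f)) (H f) ⟩
        1ℚ * B w (H f) (H f) + d * B w (G.image (H f)) (H f)
          ≡⟨ cong₂ (λ x y → x + d * y) (*-identityˡ (B w (H f) (H f))) (B-comm w (G.image (H f)) (H f)) ⟩
        B w (H f) (H f) + d * B w (H f) (G.image (H f)) ∎)))
      where open ≡-Reasoning

    -- τ = Tr(HMGMGM); Cauchy-Schwarz against Tr(HM) bounds it below.
    τ : ℚ
    τ = sum λ f → w f * B w (G f) (H.image (G f))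

    square-resolvent : ⟨ G , G ⟩ ≡ ⟨ G , H ⟩ + d * τ
    square-resolvent = begin
      sum (λ f → w f * B w (G f) (G f))
        ≡⟨ sum-cong-≗ (λ f → trans (cong (w f *_) (step f))
             (solve 4 (λ w a b d → w :* (a :+ d :* b) := con 1ℚ :* (w :* a) :+ d :* (w :* b)) refl
               (w f) (B w (G f) (H f)) (B w (G f) (H.image (G f))) d)) ⟩
      sum (λ f → 1ℚ * (w f * B w (G f) (H f)) + d * (w f * B w (G f) (H.image (G f))))
        ≡⟨ sum-comb 1ℚ (λ f → w f * B w (G f) (H f)) d (λ f → w f * B w (G f) (H.image (G f))) ⟩
      1ℚ * ⟨ G , H ⟩ + d * τ
        ≡⟨ cong (_+ d * τ) (*-identityˡ ⟨ G , H ⟩) ⟩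
      ⟨ G , H ⟩ + d * τ ∎
      where
      open ≡-Reasoning
      step : ∀ f → B w (G f) (G f) ≡ B w (G f) (H f) + d * B w (G f) (H.image (G f))
      step f = trans (B-cong {c = w} {p = G f} (λ _ → refl) (λ _ → refl) (G-via-H f))
        (trans (B-combʳ w (G f) 1ℚ (H f) d (H.image (G f)))
          (cong (_+ d * B w (G f) (H.image (G f))) (*-identityˡ (B w (G f) (H f)))))

    -- The shifted form is nonnegative at HM(G f) - x (H f); weight this by `w f` and sum over f.
    -- Leaving x free avoids dividing by a trace.
    τ-bound : ∀ x → 0ℚ ≤ τ + (- (x + x) * ⟨ G , H ⟩ + x * x * trace w H)
    τ-bound x = subst (0ℚ ≤_) total (sum-nonneg λ f → 0≤* (<⇒≤ (w>0 f)) (form≥0 f))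
      where
      open ≡-Reasoning
      c′ : Vector ℚ m
      c′ = comb 1ℚ c d w
      p : Kernel m
      p f = comb 1ℚ (H.image (G f)) (- x) (H f)
      form≥0 : ∀ f → 0ℚ ≤ B c′ (p f) (p f)
      form≥0 f = H.psd (p f) (W-comb 1ℚ (- x) (H.image∈W (G f)) (H.mem f))
      form : ∀ f → B c′ (p f) (p f) ≡
        B w (G f) (H.image (G f)) + (- (x + x) * B w (G f) (H f) + x * x * H f f)
      form f = begin
        B c′ (p f) (p f)
          ≡⟨ B-comb² c′ 1ℚ (H.image (G f)) (- x) (H f) ⟩
        1ℚ * 1ℚ * B c′ (H.image (G f)) (H.image (G f)) +
          (1ℚ * - x * B c′ (H.image (G f)) (H f) + 1ℚ * - x * B c′ (H.image (G f)) (H f)) +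
          - x * - x * B c′ (H f) (H f)
          ≡⟨ cong₂ _+_ (cong₂ (λ r s → 1ℚ * 1ℚ * r + (1ℚ * - x * s + 1ℚ * - x * s))
               (H.image-adjoint (G f) (H.image (G f)) (H.image∈W (G f)))
               (H.image-adjoint (G f) (H f) (H.mem f)))
               (cong (- x * - x *_) (H.rep (H f) (H.mem f) f)) ⟩
        1ℚ * 1ℚ * B w (G f) (H.image (G f)) +
          (1ℚ * - x * B w (G f) (H f) + 1ℚ * - x * B w (G f) (H f)) + - x * - x * H f f
          ≡⟨ solve 4 (λ x r s h → con 1ℚ :* con 1ℚ :* r :+ (con 1ℚ :* :- x :* s :+ con 1ℚ :* :- x :* s)
               :+ :- x :* :- x :* h := r :+ (:- (x :+ x) :* s :+ x :* x :* h)) refl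
               x (B w (G f) (H.image (G f))) (B w (G f) (H f)) (H f f) ⟩
        B w (G f) (H.image (G f)) + (- (x + x) * B w (G f) (H f) + x * x * H f f) ∎
      total : sum (λ f → w f * B c′ (p f) (p f)) ≡ τ + (- (x + x) * ⟨ G , H ⟩ + x * x * trace w H)
      total = begin
        sum (λ f → w f * B c′ (p f) (p f))
          ≡⟨ sum-cong-≗ (λ f → trans (cong (w f *_) (form f))
               (solve 6 (λ w r s h y z → w :* (r :+ (y :* s :+ z :* h)) :=
                  w :* r :+ (y :* (w :* s) :+ z :* (w :* h))) refl
                 (w f) (B w (G f) (H.image (G f))) (B w (G f) (H f)) (H f f) (- (x + x)) (x * x))) ⟩
        sum (λ f → w f * B w (G f) (H.image (G f)) +
                   (- (x + x) * (w f * B w (G f) (H f)) + x * x * (w f * H f f)))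
          ≡⟨ ∑-distrib-+ (λ f → w f * B w (G f) (H.image (G f)))
               (λ f → - (x + x) * (w f * B w (G f) (H f)) + x * x * (w f * H f f)) ⟩
        τ + sum (λ f → - (x + x) * (w f * B w (G f) (H f)) + x * x * (w f * H f f))
          ≡⟨ cong (τ +_) (sum-comb (- (x + x)) (λ f → w f * B w (G f) (H f)) (x * x) (λ f → w f * H f f)) ⟩
        τ + (- (x + x) * ⟨ G , H ⟩ + x * x * trace w H) ∎

  -- Sherman-Morrison
  module RankOne {c H} (inv : Inverse c H) (g : Fin m) (t : ℚ) {r : ℚ}
    (tH<1 : t * H g g < 1ℚ) (r-inverse : (1ℚ - t * H g g) * r ≡ 1ℚ) where
    open Inverse inv

    updated : Kernel m
    updated f = comb 1ℚ (H f) (t * r * H f g) (H g)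

    updated-inverse : Inverse (comb 1ℚ c (- t) (δ g)) updated
    updated-inverse = record
      { mem = λ f → W-comb 1ℚ (t * r * H f g) (mem f) (mem g)
      ; rep = λ p p∈W f → begin
          B (comb 1ℚ c (- t) (δ g)) (updated f) p
            ≡⟨ B-form 1ℚ c (- t) (δ g) (updated f) p ⟩
          1ℚ * B c (updated f) p + - t * B (δ g) (updated f) p
            ≡⟨ cong₂ (λ x y → 1ℚ * x + - t * y)
                 (trans (B-combˡ c 1ℚ (H f) (t * r * H f g) (H g) p)
                    (cong₂ (λ x y → 1ℚ * x + t * r * H f g * y) (rep p p∈W f) (rep p p∈W g)))
                 (B-δ g (updated f) p) ⟩
          1ℚ * (1ℚ * p f + t * r * H f g * p g) + - t * ((1ℚ * H f g + t * r * H f g * H g g) * p g)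
            ≡⟨ solve 6 (λ p q t r x h →
                 con 1ℚ :* (con 1ℚ :* p :+ t :* r :* x :* q) :+ :- t :* ((con 1ℚ :* x :+ t :* r :* x :* h) :* q)
                 := p :+ t :* x :* q :* ((con 1ℚ :- t :* h) :* r :- con 1ℚ)) refl
                 (p f) (p g) t r (H f g) (H g g) ⟩
          p f + t * H f g * p g * ((1ℚ - t * H g g) * r - 1ℚ)
            ≡⟨ cong (λ x → p f + t * H f g * p g * (x - 1ℚ)) r-inverse ⟩
          p f + t * H f g * p g * (1ℚ - 1ℚ)
            ≡⟨ solve 2 (λ p y → p :+ y :* (con 1ℚ :- con 1ℚ) := p) refl (p f) (t * H f g * p g) ⟩
          p f ∎
      ; psd = λ p p∈W → subst (0ℚ ≤_) (sym (trans (B-form 1ℚ c (- t) (δ g) p p)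
                (cong₂ (λ x y → x + - t * y) (*-identityˡ (B c p p)) (B-δ g p p)))) (nonneg p p∈W) }
      where
      open ≡-Reasoning
      nonneg : ∀ p → W p → 0ℚ ≤ B c p p + - t * (p g * p g)
      nonneg p p∈W with ≤-total 0ℚ t
      -- Subtracting t p_g² is harmless since p_g² ≤ B c p p · H g g and t H g g < 1.
      ... | inj₁ t≥0 = ≤-by
        (B c p p * (1ℚ - t * H g g) + t * (B c p p * H g g - p g * p g))
        (0≤+ (0≤* (psd p p∈W) (<⇒≤ (0<b-a tH<1))) (0≤* t≥0 (0≤b-a (cauchySchwarz p∈W g))))
        (solve 4 (λ b t h s → con 0ℚ :+ (b :* (con 1ℚ :- t :* h) :+ t :* (b :* h :- s)) := b :+ :- t :* s) refl
          (B c p p) t (H g g) (p g * p g))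
      ... | inj₂ t≤0 = 0≤+ (psd p p∈W) (0≤* (neg-antimono-≤ t≤0) (0≤a² (p g)))

    trace-updated : trace w updated ≡ trace w H + t * r * B w (H g) (H g)
    trace-updated = begin
      sum (λ e → w e * updated e e)
        ≡⟨ sum-cong-≗ (λ e → trans (cong (λ x → w e * (1ℚ * H e e + t * r * x * H g e)) (symm e g))
             (solve 4 (λ w h s x → w :* (con 1ℚ :* h :+ s :* x :* x) := con 1ℚ :* (w :* h) :+ s :* (w :* (x :* x)))
               refl (w e) (H e e) (t * r) (H g e))) ⟩
      sum (λ e → 1ℚ * (w e * H e e) + t * r * (w e * (H g e * H g e)))
        ≡⟨ sum-comb 1ℚ (λ e → w e * H e e) (t * r) (λ e → w e * (H g e * H g e)) ⟩
      1ℚ * trace w H + t * r * B w (H g) (H g)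
        ≡⟨ cong (_+ t * r * B w (H g) (H g)) (*-identityˡ (trace w H)) ⟩
      trace w H + t * r * B w (H g) (H g) ∎
      where open ≡-Reasoning

-- The barrier argument

module Barriers {m} {w : Vector ℚ m} (w>0 : ∀ e → 0ℚ < w e)
  {W : Vector ℚ m → Set} (W-sub : IsSubspace W) {G⁰ : Kernel m} (inv⁰ : Inverses.Inverse w>0 W-sub w G⁰)
  {e₀ : Fin m} {q₀ : Vector ℚ m} (q₀∈W : W q₀) (q₀≢0 : q₀ e₀ ≢ 0ℚ) where
  open Inverses w>0 W-sub

  -- If `H e₀ e₀` vanished, Cauchy-Schwarz would force `q₀ e₀` to be 0. Positivity makes the change
  -- Δ of a potential under a barrier shift invertible below.
  ⟨H,H⟩>0 : ∀ {c H} → Inverse c H → 0ℚ < ⟨ H , H ⟩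
  ⟨H,H⟩>0 {c} {H} inv = <-≤-trans
    (0<* (w>0 e₀) (0<* (w>0 e₀) (0<* diagonal>0 diagonal>0)))
    (≤-trans (*-monoˡ-≤ (<⇒≤ (w>0 e₀)) (term≤sum (λ f → 0≤* (<⇒≤ (w>0 f)) (0≤a² (H e₀ f))) e₀))
      (term≤sum (λ e → 0≤* (<⇒≤ (w>0 e)) (B-nonneg (λ f → <⇒≤ (w>0 f)) (H e))) e₀))
    where
    open Inverse inv
    diagonal>0 : 0ℚ < H e₀ e₀
    diagonal>0 with H e₀ e₀ ≤? 0ℚ
    ... | no ≰0 = ≰⇒> ≰0
    ... | yes ≤0 = contradiction (a²≤0⇒a≡0 (q₀ e₀) (≤-trans (cauchySchwarz q₀∈W e₀)
      (≤-trans (*-monoˡ-≤ (psd q₀ q₀∈W) ≤0) (≤-reflexive (*-zeroʳ (B c q₀ q₀)))))) q₀≢0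

  -- If t U g < 1, the barrier shift pays for adding the edge g with weight t;
  -- dually, if t L g ≡ 1 below, the edge pays for the shift.
  record UpperShift (c : Vector ℚ m) (G : Kernel m) (d d⁻¹ : ℚ) : Set where
    field
      U      : Vector ℚ m
      U≥0    : ∀ e → 0ℚ ≤ U e
      sum≤   : sum (λ e → w e * U e) ≤ d⁻¹ + trace w G
      update : ∀ g t → 0ℚ < t → t * U g < 1ℚ → ∃ λ H′ →
        Inverse (comb 1ℚ (comb 1ℚ c d w) (- t) (δ g)) H′ × trace w H′ ≤ trace w G

  -- Let H be the inverse after the shift, which lowers the potential by Δ, and let Q g = (HMH) g g.
  -- By Sherman-Morrison, weight t on g adds t Q g / (1 - t H g g) to the trace. This is at most Δ
  -- when t (Q g / Δ + H g g) ≤ 1, and the bracket is `U g`. In the sum of w U, the first part is at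
  -- most 1/d because Δ = d ⟨ G , H ⟩ ≥ d ⟨ H , H ⟩, and the second is Tr(HM) ≤ Tr(GM).
  upperShift : ∀ {c G d d⁻¹} → 0ℚ < d → d * d⁻¹ ≡ 1ℚ → Inverse c G → UpperShift c G d d⁻¹
  upperShift {c} {G} {d} {d⁻¹} d>0 dd⁻¹≡1 invG = record
    { U = U
    ; U≥0 = λ e → 0≤+ (0≤* (<⇒≤ ρ>0) (Q≥0 e)) (H.diagonal≥0 e)
    ; sum≤ = begin
        sum (λ e → w e * U e)
          ≡⟨ sum-cong-≗ (λ e → solve 4 (λ w r q h → w :* (r :* q :+ h) := r :* (w :* q) :+ con 1ℚ :* (w :* h)) refl
               (w e) ρ (Q e) (H e e)) ⟩
        sum (λ e → ρ * (w e * Q e) + 1ℚ * (w e * H e e))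
          ≡⟨ sum-comb ρ (λ e → w e * Q e) 1ℚ (λ e → w e * H e e) ⟩
        ρ * ⟨ H , H ⟩ + 1ℚ * trace w H
          ≤⟨ +-mono-≤ ρQ≤d⁻¹ (≤-by Δ (<⇒≤ Δ>0) (trans (cong (_+ Δ) (*-identityˡ (trace w H)))
               (sym (trace-resolvent d≥0 invG invH)))) ⟩
        d⁻¹ + trace w G ∎
    ; update = update }
    where
    open ≤-Reasoning
    d≥0 : 0ℚ ≤ d
    d≥0 = <⇒≤ d>0
    module G = Inverse invG
    c′ : Vector ℚ m
    c′ = comb 1ℚ c d w
    c′-form : ∀ p → B c′ p p ≡ B c p p + d * B w p p
    c′-form p = trans (B-form 1ℚ c d w p p) (cong (_+ d * B w p p) (*-identityˡ (B c p p)))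
    existence : ∃ (Inverse c′)
    existence = Inverse-exists inv⁰
      (λ p p∈W → subst (0ℚ ≤_) (sym (c′-form p)) (0≤+ (G.psd p p∈W) (0≤* d≥0 (B-nonneg (λ f → <⇒≤ (w>0 f)) p))))
      (λ p p∈W ≤0 → B-definite w>0 p (*-cancelˡ-≤ d>0 (≤-trans
         (≤-by _ (G.psd p p∈W) (trans (+-comm (d * B w p p) (B c p p)) (sym (c′-form p))))
         (≤-trans ≤0 (≤-reflexive (sym (*-zeroʳ d)))))))
    H : Kernel m
    H = proj₁ existence
    invH : Inverse c′ H
    invH = proj₂ existence
    module H = Inverse invH
    Q : Vector ℚ m
    Q e = B w (H e) (H e)
    Q≥0 : ∀ e → 0ℚ ≤ Q e
    Q≥0 e = B-nonneg (λ f → <⇒≤ (w>0 f)) (H e)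
    Δ ρ : ℚ
    Δ = d * ⟨ G , H ⟩
    Δ>0 : 0ℚ < Δ
    Δ>0 = 0<* d>0 (<-≤-trans (⟨H,H⟩>0 invH) (square≤cross d≥0 invG invH))
    ρ = proj₁ (reciprocal Δ>0)
    ρ>0 : 0ℚ < ρ
    ρ>0 = proj₁ (proj₂ (reciprocal Δ>0))
    Δρ≡1 : Δ * ρ ≡ 1ℚ
    Δρ≡1 = proj₂ (proj₂ (reciprocal Δ>0))
    U : Vector ℚ m
    U e = ρ * Q e + H e e
    ρQ≤d⁻¹ : ρ * ⟨ H , H ⟩ ≤ d⁻¹
    ρQ≤d⁻¹ = *-cancelˡ-≤ d>0 (begin
      d * (ρ * ⟨ H , H ⟩)   ≤⟨ *-monoˡ-≤ d≥0 (*-monoˡ-≤ (<⇒≤ ρ>0) (square≤cross d≥0 invG invH)) ⟩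
      d * (ρ * ⟨ G , H ⟩)   ≡⟨ solve 3 (λ d r x → d :* (r :* x) := d :* x :* r) refl d ρ ⟨ G , H ⟩ ⟩
      Δ * ρ                 ≡⟨ trans Δρ≡1 (sym dd⁻¹≡1) ⟩
      d * d⁻¹               ∎)
    update : ∀ g t → 0ℚ < t → t * U g < 1ℚ → ∃ λ H′ →
      Inverse (comb 1ℚ c′ (- t) (δ g)) H′ × trace w H′ ≤ trace w G
    update g t t>0 tU<1 = updated , updated-inverse , (begin
      trace w updated          ≡⟨ trace-updated ⟩
      trace w H + t * r * Q g  ≤⟨ +-monoʳ-≤ (trace w H) (begin
        t * r * Q g                              ≡⟨ trans (cong (t * r * Q g *_) Δρ≡1) (*-identityʳ (t * r * Q g)) ⟨
        t * r * Q g * (Δ * ρ)                    ≡⟨ solve 5 (λ t r q D ρ → t :* r :* q :* (D :* ρ) := D :* r :* (t :* (ρ :* q))) refl t r (Q g) Δ ρ ⟩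
        Δ * r * (t * (ρ * Q g))                  ≤⟨ *-monoˡ-≤ (<⇒≤ (0<* Δ>0 r>0)) (≤-by (1ℚ - t * U g) (<⇒≤ (0<b-a tU<1))
             (solve 3 (λ t x h → t :* x :+ (con 1ℚ :- t :* (x :+ h)) := con 1ℚ :- t :* h) refl t (ρ * Q g) (H g g))) ⟩
        Δ * r * (1ℚ - t * H g g)                 ≡⟨ trans (*-assoc Δ r k) (cong (Δ *_) (*-comm r k)) ⟩
        Δ * (k * r)                              ≡⟨ trans (cong (Δ *_) kr≡1) (*-identityʳ Δ) ⟩
        Δ                                        ∎) ⟩
      trace w H + Δ            ≡⟨ trace-resolvent d≥0 invG invH ⟨
      trace w G                ∎)
      where
      tH<1 : t * H g g < 1ℚ
      tH<1 = ≤-<-trans (*-monoˡ-≤ (<⇒≤ t>0) (≤-by (ρ * Q g) (0≤* (<⇒≤ ρ>0) (Q≥0 g)) (+-comm (H g g) (ρ * Q g)))) tU<1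
      k r : ℚ
      k = 1ℚ - t * H g g
      r = proj₁ (reciprocal (0<b-a tH<1))
      r>0 : 0ℚ < r
      r>0 = proj₁ (proj₂ (reciprocal (0<b-a tH<1)))
      kr≡1 : k * r ≡ 1ℚ
      kr≡1 = proj₂ (proj₂ (reciprocal (0<b-a tH<1)))
      open RankOne invH g t tH<1 kr≡1

  record LowerShift (c : Vector ℚ m) (G : Kernel m) : Set where
    field
      L      : Vector ℚ m
      sum≥   : 1ℚ - trace w G ≤ sum (λ e → w e * L e)
      update : ∀ g t → 0ℚ < t → t * L g ≡ 1ℚ → ∃ λ H′ →
        Inverse (comb 1ℚ (comb 1ℚ c (- 1ℚ) w) (- - t) (δ g)) H′ × trace w H′ ≤ trace w G

  -- The shift raises the potential by Δ, and weight t on g lowers it by t Q g / (1 + t H g g). This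
  -- equals Δ exactly when t (Q g / Δ - H g g) = 1, whence `L`. The sum of w L is ⟨ H , H ⟩ / Δ -
  -- Tr(HM) = 1 + t₃ / Δ - Tr(GM) - Δ, so the bound amounts to Δ² ≤ t₃.
  lowerShift : ∀ {c G} → Inverse c G → trace w G < 1ℚ → LowerShift c G
  lowerShift {c} {G} invG trG<1 = record { L = L ; sum≥ = sum≥ ; update = update }
    where
    open ≤-Reasoning
    1≥0 : 0ℚ ≤ 1ℚ
    1≥0 = <⇒≤ (positive⁻¹ 1ℚ)
    module G = Inverse invG
    c′ : Vector ℚ m
    c′ = comb 1ℚ c (- 1ℚ) w
    c≗ : c ≗ comb 1ℚ c′ 1ℚ w
    c≗ e = solve 2 (λ c w → c := con 1ℚ :* (con 1ℚ :* c :+ con (- 1ℚ) :* w) :+ con 1ℚ :* w) refl (c e) (w e)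
    slack : ∀ p → W p → (1ℚ - trace w G) * B c p p ≤ B c′ p p
    slack p p∈W = ≤-by (B c p p * trace w G - B w p p) (0≤b-a (G.bound p p∈W))
      (trans (solve 3 (λ t b x → (con 1ℚ :- t) :* b :+ (b :* t :- x) := con 1ℚ :* b :+ con (- 1ℚ) :* x) refl
         (trace w G) (B c p p) (B w p p)) (sym (B-form 1ℚ c (- 1ℚ) w p p)))
    existence : ∃ (Inverse c′)
    existence = Inverse-exists inv⁰
      (λ p p∈W → ≤-trans (0≤* (<⇒≤ (0<b-a trG<1)) (G.psd p p∈W)) (slack p p∈W))
      (λ p p∈W ≤0 → G.definite p p∈W (*-cancelˡ-≤ (0<b-a trG<1)
         (≤-trans (≤-trans (slack p p∈W) ≤0) (≤-reflexive (sym (*-zeroʳ (1ℚ - trace w G)))))))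
    H : Kernel m
    H = proj₁ existence
    invH : Inverse c′ H
    invH = proj₂ existence
    module H = Inverse invH
    -- The barrier moves towards A, so the resolvent lemmas apply with `G` and `H` exchanged and
    -- shift 1.
    invG′ : Inverse (comb 1ℚ c′ 1ℚ w) G
    invG′ = Inverse-resp c≗ invG
    Q : Vector ℚ m
    Q e = B w (H e) (H e)
    Δ ρ t₃ : ℚ
    Δ = ⟨ H , G ⟩
    t₃ = τ 1≥0 invH invG′
    Δ>0 : 0ℚ < Δ
    Δ>0 = <-≤-trans (⟨H,H⟩>0 invG) (square≤cross 1≥0 invH invG′)
    ρ = proj₁ (reciprocal Δ>0)
    ρ>0 : 0ℚ < ρ
    ρ>0 = proj₁ (proj₂ (reciprocal Δ>0))
    Δρ≡1 : Δ * ρ ≡ 1ℚ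
    Δρ≡1 = proj₂ (proj₂ (reciprocal Δ>0))
    trH : trace w H ≡ trace w G + Δ
    trH = trans (trace-resolvent 1≥0 invH invG′) (cong (trace w G +_) (*-identityˡ Δ))
    ⟨H,H⟩≡ : ⟨ H , H ⟩ ≡ Δ + t₃
    ⟨H,H⟩≡ = trans (square-resolvent 1≥0 invH invG′) (cong (Δ +_) (*-identityˡ t₃))
    -- At x = Δ, `τ-bound` reads t₃ ≥ 2Δ² - Δ² Tr(GM), and the trace is below 1.
    Δ²≤t₃ : Δ * Δ ≤ t₃
    Δ²≤t₃ = ≤-by ((t₃ + (- (Δ + Δ) * Δ + Δ * Δ * trace w G)) + Δ * Δ * (1ℚ - trace w G))
      (0≤+ (τ-bound 1≥0 invH invG′ Δ) (0≤* (0≤a² Δ) (<⇒≤ (0<b-a trG<1))))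
      (solve 3 (λ D t x → D :* D :+ (t :+ (:- (D :+ D) :* D :+ D :* D :* x) :+ D :* D :* (con 1ℚ :- x)) := t) refl
        Δ t₃ (trace w G))
    L : Vector ℚ m
    L e = ρ * Q e - H e e
    sum≥ : 1ℚ - trace w G ≤ sum (λ e → w e * L e)
    sum≥ = begin
      1ℚ - trace w G
        ≡⟨ solve 2 (λ t D → con 1ℚ :- t := con 1ℚ :+ con 1ℚ :* D :- (t :+ D)) refl (trace w G) Δ ⟩
      1ℚ + 1ℚ * Δ - (trace w G + Δ)
        ≡⟨ cong₂ (λ x y → x + x * Δ - y) (sym Δρ≡1) (sym trH) ⟩
      Δ * ρ + Δ * ρ * Δ - trace w H
        ≤⟨ ≤-by (ρ * (t₃ - Δ * Δ)) (0≤* (<⇒≤ ρ>0) (0≤b-a Δ²≤t₃))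
             (solve 4 (λ r D t h → D :* r :+ D :* r :* D :- h :+ r :* (t :- D :* D)
                := r :* (D :+ t) :+ con (- 1ℚ) :* h) refl ρ Δ t₃ (trace w H)) ⟩
      ρ * (Δ + t₃) + - 1ℚ * trace w H
        ≡⟨ cong (λ x → ρ * x + - 1ℚ * trace w H) ⟨H,H⟩≡ ⟨
      ρ * ⟨ H , H ⟩ + - 1ℚ * trace w H
        ≡⟨ sum-comb ρ (λ e → w e * Q e) (- 1ℚ) (λ e → w e * H e e) ⟨
      sum (λ e → ρ * (w e * Q e) + - 1ℚ * (w e * H e e))
        ≡⟨ sum-cong-≗ (λ e → solve 4 (λ w r q h → r :* (w :* q) :+ con (- 1ℚ) :* (w :* h) := w :* (r :* q :- h)) refl
               (w e) ρ (Q e) (H e e)) ⟩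
      sum (λ e → w e * L e) ∎
    update : ∀ g t → 0ℚ < t → t * L g ≡ 1ℚ → ∃ λ H′ →
      Inverse (comb 1ℚ c′ (- - t) (δ g)) H′ × trace w H′ ≤ trace w G
    update g t t>0 tL≡1 = updated , updated-inverse , (begin
      trace w updated
        ≡⟨ trace-updated ⟩
      trace w H + - t * r * Q g
        ≡⟨ cong (trace w H +_) (trans (trans (sym (*-identityʳ (- t * r * Q g))) (cong (- t * r * Q g *_) (sym Δρ≡1)))
             (solve 6 (λ t r q D ρ h → :- t :* r :* q :* (D :* ρ)
                := :- (D :* r) :* (t :* (ρ :* q :- h) :+ t :* h)) refl t r (Q g) Δ ρ (H g g))) ⟩
      trace w H + - (Δ * r) * (t * L g + t * H g g)
        ≡⟨ cong (λ x → trace w H + - (Δ * r) * (x + t * H g g)) tL≡1 ⟩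
      trace w H + - (Δ * r) * (1ℚ + t * H g g)
        ≡⟨ cong (trace w H +_) (solve 4 (λ D r t h → :- (D :* r) :* (con 1ℚ :+ t :* h)
             := :- (D :* ((con 1ℚ :- :- t :* h) :* r))) refl Δ r t (H g g)) ⟩
      trace w H + - (Δ * (k * r))
        ≡⟨ cong₂ (λ x y → x + - (Δ * y)) trH kr≡1 ⟩
      trace w G + Δ + - (Δ * 1ℚ)
        ≡⟨ solve 2 (λ x D → x :+ D :+ :- (D :* con 1ℚ) := x) refl (trace w G) Δ ⟩
      trace w G ∎)
      where
      -tH<1 : - t * H g g < 1ℚ
      -tH<1 = ≤-<-trans (≤-by (t * H g g) (0≤* (<⇒≤ t>0) (H.diagonal≥0 g))
        (solve 2 (λ t h → :- t :* h :+ t :* h := con 0ℚ) refl t (H g g))) (positive⁻¹ 1ℚ)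
      k r : ℚ
      k = 1ℚ - - t * H g g
      r = proj₁ (reciprocal (0<b-a -tH<1))
      kr≡1 : k * r ≡ 1ℚ
      kr≡1 = proj₂ (proj₂ (reciprocal (0<b-a -tH<1)))
      open RankOne invH g (- t) -tH<1 kr≡1

  -- With A = diag s and M = diag w, upper = (uM − A)⁻¹ and lower = (A − lM)⁻¹.
  record Between (κ u l : ℚ) (s : Vector ℚ m) : Set where
    field
      {upper lower} : Kernel m
      upper-inverse : Inverse (comb u w (- 1ℚ) s) upper
      lower-inverse : Inverse (comb 1ℚ s (- l) w) lower
      upper-trace   : trace w upper ≤ κ
      lower-trace   : trace w lower ≤ κ

  step : ∀ {κ d d⁻¹ u l s} → 0ℚ < d → d * d⁻¹ ≡ 1ℚ → κ < 1ℚ → d⁻¹ + κ < 1ℚ - κ → Between κ u l s →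
    ∃ λ g → ∃ λ t → 0ℚ < t × Between κ (u + d) (l + 1ℚ) (comb 1ℚ s t (δ g))
  step {κ} {d} {d⁻¹} {u} {l} {s} d>0 dd⁻¹≡1 κ<1 gap st =
    g , t , t>0 , record
      { upper-inverse = Inverse-resp
          (λ e → solve 6 (λ u w s d t x → con 1ℚ :* (con 1ℚ :* (u :* w :+ con (- 1ℚ) :* s) :+ d :* w) :+ :- t :* x
             := (u :+ d) :* w :+ con (- 1ℚ) :* (con 1ℚ :* s :+ t :* x)) refl u (w e) (s e) d t (δ g e))
          (proj₁ (proj₂ up))
      ; lower-inverse = Inverse-resp
          (λ e → solve 5 (λ l w s t x → con 1ℚ :* (con 1ℚ :* (con 1ℚ :* s :+ :- l :* w) :+ con (- 1ℚ) :* w) :+ :- (:- t) :* x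
             := con 1ℚ :* (con 1ℚ :* s :+ t :* x) :+ :- (l :+ con 1ℚ) :* w) refl l (w e) (s e) t (δ g e))
          (proj₁ (proj₂ low))
      ; upper-trace = ≤-trans (proj₂ (proj₂ up)) upper-trace
      ; lower-trace = ≤-trans (proj₂ (proj₂ low)) lower-trace }
    where
    open Between st
    module U = UpperShift (upperShift d>0 dd⁻¹≡1 upper-inverse)
    module L = LowerShift (lowerShift lower-inverse (≤-<-trans lower-trace κ<1))
    sum< : sum (λ e → w e * U.U e) < sum (λ e → w e * L.L e)
    sum< = ≤-<-trans (≤-trans U.sum≤ (+-monoʳ-≤ d⁻¹ upper-trace))
      (<-≤-trans gap (≤-trans (+-monoʳ-≤ 1ℚ (neg-antimono-≤ lower-trace)) L.sum≥))
    choice : ∃ λ g → w g * U.U g < w g * L.L g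
    choice = sum-<⇒∃ (λ e → w e * U.U e) (λ e → w e * L.L e) sum<
    g : Fin m
    g = proj₁ choice
    U<L : U.U g < L.L g
    U<L = *-cancelˡ-<-nonNeg (w g) {{nonNegative (<⇒≤ (w>0 g))}} (proj₂ choice)
    L>0 : 0ℚ < L.L g
    L>0 = ≤-<-trans (U.U≥0 g) U<L
    -- The weight that the lower update demands; it meets the upper condition since U < L at `g`.
    t : ℚ
    t = proj₁ (reciprocal L>0)
    t>0 : 0ℚ < t
    t>0 = proj₁ (proj₂ (reciprocal L>0))
    tL≡1 : t * L.L g ≡ 1ℚ
    tL≡1 = trans (*-comm t (L.L g)) (proj₂ (proj₂ (reciprocal L>0)))
    tU<1 : t * U.U g < 1ℚ
    tU<1 = subst (t * U.U g <_) tL≡1 (*-monoʳ-<-pos t {{positive t>0}} U<L)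
    up : ∃ λ H′ → Inverse (comb 1ℚ (comb 1ℚ (comb u w (- 1ℚ) s) d w) (- t) (δ g)) H′ × trace w H′ ≤ trace w upper
    up = U.update g t t>0 tU<1
    low : ∃ λ H′ → Inverse (comb 1ℚ (comb 1ℚ (comb 1ℚ s (- l) w) (- 1ℚ) w) (- - t) (δ g)) H′ × trace w H′ ≤ trace w lower
    low = L.update g t t>0 tL≡1

-- Spectral sparsifiers

ι-+ : ∀ a b → ι (a ℕ.+ b) ≡ ι a + ι b
ι-+ zero    b = sym (+-identityˡ (ι b))
ι-+ (suc a) b = trans (cong (_+ 1ℚ) (ι-+ a b))
  (solve 2 (λ x y → x :+ y :+ con 1ℚ := x :+ con 1ℚ :+ y) refl (ι a) (ι b))

ι-* : ∀ a b → ι (a ℕ.* b) ≡ ι a * ι b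
ι-* zero    b = sym (*-zeroˡ (ι b))
ι-* (suc a) b = trans (ι-+ b (a ℕ.* b)) (trans (cong (ι b +_) (ι-* a b))
  (solve 2 (λ x y → y :+ x :* y := (x :+ con 1ℚ) :* y) refl (ι a) (ι b)))

ι≥0 : ∀ n → 0ℚ ≤ ι n
ι≥0 zero    = ≤-refl
ι≥0 (suc n) = 0≤+ (ι≥0 n) (<⇒≤ (positive⁻¹ 1ℚ))

ι-mono : ∀ {a b} → a ℕ.≤ b → ι a ≤ ι b
ι-mono {b = b} ℕ.z≤n = ι≥0 b
ι-mono (ℕ.s≤s a≤b) = +-monoˡ-≤ 1ℚ (ι-mono a≤b)

δ≥0 : ∀ {m} (g e : Fin m) → 0ℚ ≤ δ g e
δ≥0 zero    zero    = <⇒≤ (positive⁻¹ 1ℚ)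
δ≥0 zero    (suc e) = ≤-refl
δ≥0 (suc g) zero    = ≤-refl
δ≥0 (suc g) (suc e) = δ≥0 g e

δ-diagonal : ∀ {m} (g : Fin m) → δ g g ≡ 1ℚ
δ-diagonal zero    = refl
δ-diagonal (suc g) = δ-diagonal g

δ-off-diagonal : ∀ {m} (g e : Fin m) → g ≢ e → δ g e ≡ 0ℚ
δ-off-diagonal zero    zero    g≢e = contradiction refl g≢e
δ-off-diagonal zero    (suc e) g≢e = refl
δ-off-diagonal (suc g) zero    g≢e = refl
δ-off-diagonal (suc g) (suc e) g≢e = δ-off-diagonal g e (λ g≡e → g≢e (cong suc g≡e))

∣p∪q∣≤∣p∣+∣q∣ : ∀ {m} (p q : Subset m) → ∣ p ∪ q ∣ ℕ.≤ ∣ p ∣ ℕ.+ ∣ q ∣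
∣p∪q∣≤∣p∣+∣q∣ []          []          = ℕ.z≤n
∣p∪q∣≤∣p∣+∣q∣ (true  ∷ p) (true  ∷ q) = ℕ.s≤s (ℕₚ.≤-trans (∣p∪q∣≤∣p∣+∣q∣ p q) (ℕₚ.+-monoʳ-≤ ∣ p ∣ (ℕₚ.n≤1+n ∣ q ∣)))
∣p∪q∣≤∣p∣+∣q∣ (true  ∷ p) (false ∷ q) = ℕ.s≤s (∣p∪q∣≤∣p∣+∣q∣ p q)
∣p∪q∣≤∣p∣+∣q∣ (false ∷ p) (true  ∷ q) = ℕₚ.≤-trans (ℕ.s≤s (∣p∪q∣≤∣p∣+∣q∣ p q)) (ℕₚ.≤-reflexive (sym (ℕₚ.+-suc ∣ p ∣ ∣ q ∣)))
∣p∪q∣≤∣p∣+∣q∣ (false ∷ p) (false ∷ q) = ∣p∪q∣≤∣p∣+∣q∣ p q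

record IsSupport {m} (χ : Subset m) (s : Vector ℚ m) : Set where
  field
    inside>0  : ∀ {e} → e ∈ χ → 0ℚ < s e
    outside≡0 : ∀ {e} → e ∉ χ → s e ≡ 0ℚ

  nonneg : ∀ e → 0ℚ ≤ s e
  nonneg e with e ∈? χ
  ... | yes e∈χ = <⇒≤ (inside>0 e∈χ)
  ... | no e∉χ = ≤-reflexive (sym (outside≡0 e∉χ))

-- The edge may have been chosen before; its weights then add up and the support does not grow.
insertSupport : ∀ {m} {χ : Subset m} {s} g {t} → 0ℚ < t → IsSupport χ s →
  IsSupport (χ ∪ ⁅ g ⁆) (comb 1ℚ s t (δ g))
insertSupport {χ = χ} {s} g {t} t>0 supp = record
  { inside>0 = λ {e} e∈ → case e (x∈p∪q⁻ χ ⁅ g ⁆ e∈)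
  ; outside≡0 = λ {e} e∉ → begin
      1ℚ * s e + t * δ g e
        ≡⟨ cong₂ (λ x y → 1ℚ * x + t * y) (outside≡0 (λ e∈χ → e∉ (x∈p∪q⁺ (inj₁ e∈χ))))
             (δ-off-diagonal g e λ { refl → e∉ (x∈p∪q⁺ {p = χ} (inj₂ (x∈⁅x⁆ g))) }) ⟩
      1ℚ * 0ℚ + t * 0ℚ
        ≡⟨ solve 1 (λ t → con 1ℚ :* con 0ℚ :+ t :* con 0ℚ := con 0ℚ) refl t ⟩
      0ℚ ∎ }
  where
  open ≡-Reasoning
  open IsSupport supp
  case : ∀ e → e ∈ χ ⊎ e ∈ ⁅ g ⁆ → 0ℚ < 1ℚ * s e + t * δ g e
  case e (inj₁ e∈χ) = subst (λ x → 0ℚ < x + t * δ g e) (sym (*-identityˡ (s e)))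
    (0<+ (inside>0 e∈χ) (0≤* (<⇒≤ t>0) (δ≥0 g e)))
  case e (inj₂ e∈g) with refl ← x∈⁅y⁆⇒x≡y g e∈g = subst₂ (λ x y → 0ℚ < x + y) (sym (*-identityˡ (s g)))
    (trans (sym (*-identityʳ t)) (cong (t *_) (sym (δ-diagonal g))))
    (+-mono-≤-< (nonneg g) t>0)

record Sparsified {m} (w : Vector ℚ m) (κ : ℚ) (T : ℕ) (Target : Vector ℚ m → Set) : Set where
  field
    {σ}     : Vector ℚ m
    {χ}     : Subset m
    ∣χ∣≤    : ∣ χ ∣ ℕ.≤ T
    support : IsSupport χ σ
    lower   : ∀ {p} → Target p → (1ℚ - κ) * B w p p ≤ B σ p p
    upper   : ∀ {p} → Target p → B σ p p ≤ (1ℚ + ι 7 * κ) * B w p p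

-- With barriers starting at ±N k and moving by 1 + 6κ and 1 per step, where
-- κ = 1 / k, after T = N k² steps u/T = 1 + 7κ and l/T = 1 − κ.
module _ {m} {w : Vector ℚ m} (w>0 : ∀ e → 0ℚ < w e)
  {W : Vector ℚ m → Set} (W-sub : IsSubspace W) {G⁰ : Kernel m} (inv⁰ : Inverses.Inverse w>0 W-sub w G⁰)
  {e₀ : Fin m} {q₀ : Vector ℚ m} (q₀∈W : W q₀) (q₀≢0 : q₀ e₀ ≢ 0ℚ)
  {N : ℕ} (N>0 : 0ℚ < ι N) (trace≤N : trace w G⁰ ≤ ι N)
  {k : ℕ} (k≥12 : ι 12 ≤ ι k) {κ : ℚ} (κ>0 : 0ℚ < κ) (kκ≡1 : ι k * κ ≡ 1ℚ) where
  open Inverses w>0 W-sub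
  open Barriers w>0 W-sub inv⁰ q₀∈W q₀≢0

  private
    ν k′ d d⁻¹ u₀ b : ℚ
    ν = ι N
    k′ = ι k
    d = 1ℚ + ι 6 * κ
    k>0 : 0ℚ < k′
    k>0 = <-≤-trans (positive⁻¹ (ι 12)) k≥12
    d>0 : 0ℚ < d
    d>0 = 0<+ (positive⁻¹ 1ℚ) (0≤* (ι≥0 6) (<⇒≤ κ>0))
    d⁻¹ = proj₁ (reciprocal d>0)
    dd⁻¹≡1 : d * d⁻¹ ≡ 1ℚ
    dd⁻¹≡1 = proj₂ (proj₂ (reciprocal d>0))
    u₀ = ν * k′
    u₀>0 : 0ℚ < u₀
    u₀>0 = 0<* N>0 k>0
    b = proj₁ (reciprocal u₀>0)
    b>0 : 0ℚ < b
    b>0 = proj₁ (proj₂ (reciprocal u₀>0))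
    u₀b≡1 : u₀ * b ≡ 1ℚ
    u₀b≡1 = proj₂ (proj₂ (reciprocal u₀>0))

    12κ≤1 : ι 12 * κ ≤ 1ℚ
    12κ≤1 = ≤-trans (*-monoʳ-≤-nonNeg κ {{nonNegative (<⇒≤ κ>0)}} k≥12) (≤-reflexive kκ≡1)

    κ<1 : κ < 1ℚ
    κ<1 = <-≤-trans (<-by (ι 11 * κ) (0<* (positive⁻¹ (ι 11)) κ>0)
      (solve 1 (λ κ → κ :+ con (ι 11) :* κ := con (ι 12) :* κ) refl κ)) 12κ≤1

    gap : d⁻¹ + κ < 1ℚ - κ
    gap = ≤-<-trans (+-monoˡ-≤ κ d⁻¹≤)
      (<-by (ι 2 * κ) (0<* (positive⁻¹ (ι 2)) κ>0)
        (solve 1 (λ κ → con 1ℚ :- con (ι 4) :* κ :+ κ :+ con (ι 2) :* κ := con 1ℚ :- κ) refl κ))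
      where
      -- (1 + 6κ)(1 - 4κ) = 1 + 2κ(1 - 12κ) is at least 1 because κ ≤ 1/12; this is the source of
      -- the constant 12.
      d⁻¹≤ : d⁻¹ ≤ 1ℚ - ι 4 * κ
      d⁻¹≤ = *-cancelˡ-≤ d>0 (≤-trans (≤-reflexive dd⁻¹≡1)
        (≤-by (ι 2 * κ * (1ℚ - ι 12 * κ)) (0≤* (0≤* (ι≥0 2) (<⇒≤ κ>0)) (0≤b-a 12κ≤1))
          (solve 1 (λ κ → con 1ℚ :+ con (ι 2) :* κ :* (con 1ℚ :- con (ι 12) :* κ)
             := (con 1ℚ :+ con (ι 6) :* κ) :* (con 1ℚ :- con (ι 4) :* κ)) refl κ)))

    -- With A = 0 and barriers at ±u₀ both forms are u₀ M. The inverse is G⁰ / u₀, of potential at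
    -- most N / (N k) = κ.
    initial : Between κ u₀ (- u₀) (λ _ → 0ℚ)
    initial = record
      { upper-inverse = Inverse-resp (λ e → solve 2 (λ u w → u :* w := u :* w :+ con (- 1ℚ) :* con 0ℚ) refl u₀ (w e)) scaled
      ; lower-inverse = Inverse-resp (λ e → solve 2 (λ u w → u :* w := con 1ℚ :* con 0ℚ :+ :- (:- u) :* w) refl u₀ (w e)) scaled
      ; upper-trace = trace≤κ
      ; lower-trace = trace≤κ }
      where
      open ≤-Reasoning
      scaled : Inverse (λ e → u₀ * w e) (λ e f → b * G⁰ e f)
      scaled = Inverse-scale u₀ b (<⇒≤ u₀>0) u₀b≡1 inv⁰
      trace≤κ : trace w (λ e f → b * G⁰ e f) ≤ κ
      trace≤κ = begin
        sum (λ e → w e * (b * G⁰ e e))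
          ≡⟨ sum-cong-≗ (λ e → solve 3 (λ w b g → w :* (b :* g) := b :* (w :* g)) refl (w e) b (G⁰ e e)) ⟩
        sum (λ e → b * (w e * G⁰ e e))
          ≡⟨ *-distribˡ-sum b (λ e → w e * G⁰ e e) ⟨
        b * trace w G⁰
          ≤⟨ *-monoˡ-≤ (<⇒≤ b>0) trace≤N ⟩
        b * ν
          ≡⟨ trans (cong (b * ν *_) kκ≡1) (*-identityʳ (b * ν)) ⟨
        b * ν * (k′ * κ)
          ≡⟨ solve 4 (λ b n k κ → b :* n :* (k :* κ) := n :* k :* b :* κ) refl b ν k′ κ ⟩
        u₀ * b * κ
          ≡⟨ trans (cong (_* κ) u₀b≡1) (*-identityˡ κ) ⟩
        κ ∎

    record Stage (T : ℕ) : Set where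
      field
        {s}     : Vector ℚ m
        {χ}     : Subset m
        ∣χ∣≤    : ∣ χ ∣ ℕ.≤ T
        support : IsSupport χ s
        between : Between κ (u₀ + ι T * d) (- u₀ + ι T) s

    stage : ∀ T → Stage T
    stage zero = record
      { χ = ⊥
      ; ∣χ∣≤ = ℕₚ.≤-reflexive (∣⊥∣≡0 m)
      ; support = record { inside>0 = λ e∈⊥ → contradiction e∈⊥ ∉⊥ ; outside≡0 = λ _ → refl }
      ; between = subst₂ (λ u l → Between κ u l (λ _ → 0ℚ))
          (solve 2 (λ u d → u := u :+ con 0ℚ :* d) refl u₀ d) (sym (+-identityʳ (- u₀))) initial }
    stage (suc T) = record
      { χ = S.χ ∪ ⁅ g ⁆
      ; ∣χ∣≤ = ℕₚ.≤-trans (∣p∪q∣≤∣p∣+∣q∣ S.χ ⁅ g ⁆)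
          (ℕₚ.≤-trans (ℕₚ.+-mono-≤ S.∣χ∣≤ (ℕₚ.≤-reflexive (∣⁅x⁆∣≡1 g))) (ℕₚ.≤-reflexive (ℕₚ.+-comm T 1)))
      ; support = insertSupport g (proj₁ (proj₂ (proj₂ next))) S.support
      ; between = subst₂ (λ u l → Between κ u l (comb 1ℚ S.s t (δ g)))
          (solve 3 (λ u d t → u :+ t :* d :+ d := u :+ (t :+ con 1ℚ) :* d) refl u₀ d (ι T))
          (+-assoc (- u₀) (ι T) 1ℚ) (proj₂ (proj₂ (proj₂ next))) }
      where
      module S = Stage (stage T)
      next : ∃ λ g → ∃ λ t → 0ℚ < t × Between κ (u₀ + ι T * d + d) (- u₀ + ι T + 1ℚ) (comb 1ℚ S.s t (δ g))
      next = step d>0 dd⁻¹≡1 κ<1 gap S.between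
      g : Fin m
      g = proj₁ next
      t : ℚ
      t = proj₁ (proj₂ next)

  -- Positivity of the two forms after T steps says l M ≤ A ≤ u M on W; it remains to divide by T.
  sparsifySubspace : Sparsified w κ (N ℕ.* (k ℕ.* k)) W
  sparsifySubspace = record
    { σ = λ e → η * s e
    ; χ = χ
    ; ∣χ∣≤ = ∣χ∣≤
    ; support = record
        { inside>0 = λ e∈χ → 0<* η>0 (inside>0 e∈χ)
        ; outside≡0 = λ e∉χ → trans (cong (η *_) (outside≡0 e∉χ)) (*-zeroʳ η) }
    ; lower = λ {p} p∈W → begin
        (1ℚ - κ) * B w p p
          ≡⟨ cong (λ x → (x - κ) * B w p p) ηT≡1 ⟨
        (η * ι T - κ) * B w p p
          ≡⟨ cong (λ x → (η * ι T - x) * B w p p) ηu₀≡κ ⟨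
        (η * ι T - η * u₀) * B w p p
          ≡⟨ solve 4 (λ h t u x → (h :* t :- h :* u) :* x := h :* ((:- u :+ t) :* x)) refl η (ι T) u₀ (B w p p) ⟩
        η * ((- u₀ + ι T) * B w p p)
          ≤⟨ *-monoˡ-≤ (<⇒≤ η>0) (≤-by _ (Inverse.psd lower-inverse p p∈W) (trans
               (cong ((- u₀ + ι T) * B w p p +_) (B-form 1ℚ s (- (- u₀ + ι T)) w p p))
               (solve 3 (λ l x y → l :* x :+ (con 1ℚ :* y :+ :- l :* x) := y) refl (- u₀ + ι T) (B w p p) (B s p p)))) ⟩
        η * B s p p
          ≡⟨ B-scale p ⟨
        B (λ e → η * s e) p p ∎
    ; upper = λ {p} p∈W → begin
        B (λ e → η * s e) p p
          ≡⟨ B-scale p ⟩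
        η * B s p p
          ≤⟨ *-monoˡ-≤ (<⇒≤ η>0) (≤-by _ (Inverse.psd upper-inverse p p∈W) (trans
               (cong (B s p p +_) (B-form (u₀ + ι T * d) w (- 1ℚ) s p p))
               (solve 3 (λ l x y → y :+ (l :* x :+ con (- 1ℚ) :* y) := l :* x) refl (u₀ + ι T * d) (B w p p) (B s p p)))) ⟩
        η * ((u₀ + ι T * d) * B w p p)
          ≡⟨ solve 5 (λ h t u x k → h :* ((u :+ t :* (con 1ℚ :+ con (ι 6) :* k)) :* x)
               := (h :* u :+ h :* t :* (con 1ℚ :+ con (ι 6) :* k)) :* x) refl η (ι T) u₀ (B w p p) κ ⟩
        (η * u₀ + η * ι T * (1ℚ + ι 6 * κ)) * B w p p
          ≡⟨ cong₂ (λ x y → (x + y * (1ℚ + ι 6 * κ)) * B w p p) ηu₀≡κ ηT≡1 ⟩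
        (κ + 1ℚ * (1ℚ + ι 6 * κ)) * B w p p
          ≡⟨ solve 2 (λ k x → (k :+ con 1ℚ :* (con 1ℚ :+ con (ι 6) :* k)) :* x := (con 1ℚ :+ con (ι 7) :* k) :* x) refl κ (B w p p) ⟩
        (1ℚ + ι 7 * κ) * B w p p ∎ }
    where
    T : ℕ
    T = N ℕ.* (k ℕ.* k)
    open Stage (stage T)
    open IsSupport support
    open Between between
    open ≤-Reasoning
    -- η = κ / (N k) = 1 / T.
    η : ℚ
    η = b * κ
    η>0 : 0ℚ < η
    η>0 = 0<* b>0 κ>0
    B-scale : ∀ p → B (λ e → η * s e) p p ≡ η * B s p p
    B-scale p = trans (sum-cong-≗ λ e → *-assoc η (s e) (p e * p e)) (sym (*-distribˡ-sum η (λ e → s e * (p e * p e))))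
    ηu₀≡κ : η * u₀ ≡ κ
    ηu₀≡κ = trans (solve 3 (λ b k u → b :* k :* u := u :* b :* k) refl b κ u₀) (trans (cong (_* κ) u₀b≡1) (*-identityˡ κ))
    ηT≡1 : η * ι T ≡ 1ℚ
    ηT≡1 = trans (cong (η *_) (trans (ι-* N (k ℕ.* k)) (cong (ν *_) (ι-* k k))))
      (trans (solve 4 (λ b κ n k → b :* κ :* (n :* (k :* k)) := n :* k :* b :* (k :* κ)) refl b κ ν k′)
        (trans (cong₂ _*_ u₀b≡1 kκ≡1) (*-identityˡ 1ℚ)))

-- W is taken to be the set of vectors fixed by the Gram-Schmidt projection for `w` on the vectors
-- `b`. As the solution set of linear equations it is visibly a subspace, it contains all
-- combinations of `b`, the kernel inverts `w` on it by definition, and the trace is at most `N`.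
spectralSparsifier : ∀ {m} {w : Vector ℚ m} → (∀ e → 0ℚ < w e) → ∀ {N} (b : Fin N → Vector ℚ m) {i₀ e₀} → b i₀ e₀ ≢ 0ℚ →
  ∀ {k} → ι 12 ≤ ι k → ∀ {κ} → 0ℚ < κ → ι k * κ ≡ 1ℚ →
  Sparsified w κ (N ℕ.* (k ℕ.* k)) (λ p → ∃ λ x → p ≗ (λ e → sum λ i → x i * b i e))
spectralSparsifier {m} {w} w>0 {N} b {i₀} b≢0 {k} k≥12 κ>0 kκ≡1 = record
  { ∣χ∣≤ = ∣χ∣≤ ; support = support
  ; lower = λ { (x , p≗) → lower (spanned x p≗) }
  ; upper = λ { (x , p≗) → upper (spanned x p≗) } }
  where
  everything : IsSubspace {m} (λ _ → ⊤)
  everything = record { W-resp = λ _ _ → tt ; W-comb = λ _ _ _ _ → tt ; W-sum = λ _ _ → tt }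
  definite : ∀ p → ⊤ → B w p p ≤ 0ℚ → ∀ e → p e ≡ 0ℚ
  definite p _ = B-definite w>0 p
  open Extension (gramSchmidt everything {w} definite (zeroProjection everything {w} definite) b (λ _ → tt))
  W-sub : IsSubspace (Fixes w kernel)
  W-sub = Fixes-subspace w kernel
  inverse : Inverses.Inverse w>0 W-sub w kernel
  inverse = record { mem = IsProjection.idem projection ; rep = λ p fix → fix
                   ; psd = λ p _ → B-nonneg (λ e → <⇒≤ (w>0 e)) p }
  trace≤N : trace w kernel ≤ ι N
  trace≤N = ≤-trans trace≤ (≤-reflexive (trans (cong (_+ ι N)
    (trans (sum-cong-≗ λ e → *-zeroʳ (w e)) (sum-zero m))) (+-identityˡ (ι N))))
  N>0 : ∀ {N} → Fin N → 0ℚ < ι N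
  N>0 {suc N} _ = +-mono-≤-< (ι≥0 N) (positive⁻¹ 1ℚ)
  spanned : ∀ x {p} → p ≗ (λ e → sum λ i → x i * b i e) → Fixes w kernel p
  spanned x p≗ = IsSubspace.W-resp W-sub (λ e → sym (p≗ e)) (Fixes-sum w kernel x {b} fixes)
  open Sparsified (sparsifySubspace w>0 W-sub inverse (fixes i₀) b≢0 {N = N} (N>0 i₀) trace≤N {k = k} k≥12 κ>0 kκ≡1)

-- Predicates without singleton restrictions

∣⁅i⁆∪⁅j⁆∣≡2 : ∀ {m} (i j : Fin m) → i ≢ j → ∣ ⁅ i ⁆ ∪ ⁅ j ⁆ ∣ ≡ 2
∣⁅i⁆∪⁅j⁆∣≡2 zero    zero    i≢j = contradiction refl i≢j
∣⁅i⁆∪⁅j⁆∣≡2 zero    (suc j) i≢j = cong suc (trans (cong ∣_∣ (∪-identityˡ ⁅ j ⁆)) (∣⁅x⁆∣≡1 j))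
∣⁅i⁆∪⁅j⁆∣≡2 (suc i) zero    i≢j = cong suc (trans (cong ∣_∣ (∪-identityʳ ⁅ i ⁆)) (∣⁅x⁆∣≡1 i))
∣⁅i⁆∪⁅j⁆∣≡2 (suc i) (suc j) i≢j = ∣⁅i⁆∪⁅j⁆∣≡2 i j (λ i≡j → i≢j (cong suc i≡j))

firstFalse : ∀ {d} → (Fin d → Bool) → Maybe (Fin d)
firstFalse {zero}  r = nothing
firstFalse {suc d} r = if r zero then Maybe.map suc (firstFalse (λ i → r (suc i))) else just zero

firstFalse-cong : ∀ {d} {r s : Fin d → Bool} → r ≗ s → firstFalse r ≡ firstFalse s
firstFalse-cong {zero}  r≗s = refl
firstFalse-cong {suc d} r≗s = cong₂ (λ b x → if b then Maybe.map suc x else just zero)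
  (r≗s zero) (firstFalse-cong (λ i → r≗s (suc i)))

firstFalse-just : ∀ {d} (r : Fin d → Bool) {i} → firstFalse r ≡ just i → r i ≡ false
firstFalse-just {suc d} r eq with r zero in r₀
firstFalse-just {suc d} r refl | false = r₀
firstFalse-just {suc d} r eq | true with firstFalse (λ i → r (suc i)) in first
firstFalse-just {suc d} r refl | true | just i = firstFalse-just (λ i → r (suc i)) first

firstFalse-nothing : ∀ {d} (r : Fin d → Bool) → firstFalse r ≡ nothing → ∀ i → r i ≡ true
firstFalse-nothing {suc d} r eq i with r zero in r₀
firstFalse-nothing {suc d} r eq zero | true = r₀
firstFalse-nothing {suc d} r eq (suc i) | true with firstFalse (λ i → r (suc i)) in first
firstFalse-nothing {suc d} r eq (suc i) | true | nothing = firstFalse-nothing (λ i → r (suc i)) first i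

-- P a b = [left a ≢ right b]; the two fresh labels zero and suc zero mark rows
-- and columns without zeros.
record Labelling {d} (P : Predicate d) : Set where
  field
    left right : Fin d → Fin (2 ℕ.+ d)
    false⇒≡    : ∀ a b → P a b ≡ false → left a ≡ right b
    true⇒≢     : ∀ a b → P a b ≡ true → left a ≢ right b

module _ {d} (P : Predicate d)
  (noSingleton : ∀ (B C : Subset d) → ∣ B ∣ ≡ 2 → ∣ C ∣ ≡ 2 → ¬ IsSingletonOn P B C) where

  -- Otherwise (a′, b′) would be the only one of P on {a, a′} × {b, b′}. If a = a′ or b = b′, the
  -- claim is among the hypotheses.
  fourthFalse : ∀ {a a′ b b′} → P a b ≡ false → P a′ b ≡ false → P a b′ ≡ false → P a′ b′ ≡ false
  fourthFalse {a} {a′} {b} {b′} ab a′b ab′ with a Finₚ.≟ a′ | b Finₚ.≟ b′ | P a′ b′ in a′b′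
  ... | yes refl | _        | _     = trans (sym a′b′) ab′
  ... | no _     | yes refl | _     = trans (sym a′b′) a′b
  ... | no _     | no _     | false = refl
  ... | no a≢a′  | no b≢b′  | true  = contradiction
    ((a′ , b′) , (x∈p∪q⁺ {p = ⁅ a ⁆} (inj₂ (x∈⁅x⁆ a′)) , x∈p∪q⁺ {p = ⁅ b ⁆} (inj₂ (x∈⁅x⁆ b′)) , a′b′) , unique)
    (noSingleton (⁅ a ⁆ ∪ ⁅ a′ ⁆) (⁅ b ⁆ ∪ ⁅ b′ ⁆) (∣⁅i⁆∪⁅j⁆∣≡2 a a′ a≢a′) (∣⁅i⁆∪⁅j⁆∣≡2 b b′ b≢b′))
    where
    false≢true : ∀ {x} → x ≡ false → x ≢ true
    false≢true refl ()
    unique : ∀ {xy} → proj₁ xy ∈ ⁅ a ⁆ ∪ ⁅ a′ ⁆ × proj₂ xy ∈ ⁅ b ⁆ ∪ ⁅ b′ ⁆ × P (proj₁ xy) (proj₂ xy) ≡ true →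
      (a′ , b′) ≡ xy
    unique {x , y} (x∈ , y∈ , xy) with x∈p∪q⁻ ⁅ a ⁆ ⁅ a′ ⁆ x∈ | x∈p∪q⁻ ⁅ b ⁆ ⁅ b′ ⁆ y∈
    ... | inj₁ x∈a  | inj₁ y∈b  with refl ← x∈⁅y⁆⇒x≡y a x∈a   | refl ← x∈⁅y⁆⇒x≡y b y∈b   = contradiction xy (false≢true ab)
    ... | inj₁ x∈a  | inj₂ y∈b′ with refl ← x∈⁅y⁆⇒x≡y a x∈a   | refl ← x∈⁅y⁆⇒x≡y b′ y∈b′ = contradiction xy (false≢true ab′)
    ... | inj₂ x∈a′ | inj₁ y∈b  with refl ← x∈⁅y⁆⇒x≡y a′ x∈a′ | refl ← x∈⁅y⁆⇒x≡y b y∈b   = contradiction xy (false≢true a′b)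
    ... | inj₂ x∈a′ | inj₂ y∈b′ with refl ← x∈⁅y⁆⇒x≡y a′ x∈a′ | refl ← x∈⁅y⁆⇒x≡y b′ y∈b′ = refl

  -- At a column where only one of the two rows had a zero, `fourthFalse` with the common zero
  -- column `b` would give the other row a zero too. So the zeros form disjoint rectangles.
  sameRow : ∀ {a a′ b} → P a b ≡ false → P a′ b ≡ false → P a ≗ P a′
  sameRow {a} {a′} {b} ab a′b c with P a c in ac | P a′ c in a′c
  ... | true  | true  = refl
  ... | false | false = refl
  ... | true  | false = trans (sym ac) (fourthFalse a′b ab a′c)
  ... | false | true  = trans (sym (fourthFalse ab a′b ac)) a′c

  -- The first zero of a row is a canonical name of its rectangle, as rows with a common zero are
  -- equal. A column takes the name of the first row that has a zero in it.
  labelling : Labelling P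
  labelling = record { left = left ; right = right ; false⇒≡ = false⇒≡ ; true⇒≢ = true⇒≢ }
    where
    left right : Fin d → Fin (2 ℕ.+ d)
    left a = maybe′ (λ c → suc (suc c)) zero (firstFalse (P a))
    right b = maybe′ left (suc zero) (firstFalse (λ a → P a b))

    false⇒≡ : ∀ a b → P a b ≡ false → left a ≡ right b
    false⇒≡ a b ab with firstFalse (λ a → P a b) in col
    ... | just a′ = cong (maybe′ (λ c → suc (suc c)) zero)
      (firstFalse-cong (sameRow ab (firstFalse-just (λ a → P a b) col)))
    ... | nothing with () ← trans (sym ab) (firstFalse-nothing (λ a → P a b) col a)

    true⇒≢ : ∀ a b → P a b ≡ true → left a ≢ right b
    true⇒≢ a b ab with firstFalse (λ a → P a b) in col
    true⇒≢ a b ab | nothing with firstFalse (P a)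
    ... | just _  = λ ()
    ... | nothing = λ ()
    true⇒≢ a b ab | just a′ with a′b ← firstFalse-just (λ a → P a b) col
      with firstFalse (P a) in rowₐ | firstFalse (P a′) in rowₐ′
    ... | _       | nothing with () ← trans (sym a′b) (firstFalse-nothing (P a′) rowₐ′ b)
    true⇒≢ a b ab | just a′ | nothing | just _  = λ ()
    -- Equal labels mean that rows `a` and `a′` share the zero `c`; as row `a′` also has a zero at
    -- `b`, so has row `a`.
    true⇒≢ a b ab | just a′ | just c  | just c′ = λ { refl → contradiction
      (trans (sym ab) (fourthFalse (firstFalse-just (P a′) rowₐ′) (firstFalse-just (P a) rowₐ) a′b)) λ () }

-- Labels as unit vectors

indicator : Bool → ℚ
indicator b = if b then 1ℚ else 0ℚ

indicator≥0 : ∀ b → 0ℚ ≤ indicator b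
indicator≥0 true  = <⇒≤ (positive⁻¹ 1ℚ)
indicator≥0 false = ≤-refl

difference : ∀ {L} → Fin L → Fin L → Fin L → ℚ
difference i j c = δ i c + - δ j c

sum-difference² : ∀ {L} (i j : Fin L) → sum (λ c → difference i j c * difference i j c) ≡ 1ℚ + 1ℚ - (δ i j + δ j i)
sum-difference² i j = begin
  sum (λ c → difference i j c * difference i j c)
    ≡⟨ sum-cong-≗ (λ c → solve 2 (λ x y → (x :+ :- y) :* (x :+ :- y)
         := con 1ℚ :* (x :* (x :+ :- y)) :+ con (- 1ℚ) :* (y :* (x :+ :- y))) refl (δ i c) (δ j c)) ⟩
  sum (λ c → 1ℚ * (δ i c * difference i j c) + - 1ℚ * (δ j c * difference i j c))
    ≡⟨ sum-comb 1ℚ (λ c → δ i c * difference i j c) (- 1ℚ) (λ c → δ j c * difference i j c) ⟩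
  1ℚ * sum (λ c → δ i c * difference i j c) + - 1ℚ * sum (λ c → δ j c * difference i j c)
    ≡⟨ cong₂ (λ x y → 1ℚ * x + - 1ℚ * y) (sum-δ i (difference i j)) (sum-δ j (difference i j)) ⟩
  1ℚ * (δ i i + - δ j i) + - 1ℚ * (δ i j + - δ j j)
    ≡⟨ cong₂ (λ x y → 1ℚ * (x + - δ j i) + - 1ℚ * (δ i j + - y)) (δ-diagonal i) (δ-diagonal j) ⟩
  1ℚ * (1ℚ + - δ j i) + - 1ℚ * (δ i j + - 1ℚ)
    ≡⟨ solve 2 (λ x y → con 1ℚ :* (con 1ℚ :+ :- y) :+ con (- 1ℚ) :* (x :+ :- con 1ℚ) := con 1ℚ :+ con 1ℚ :- (x :+ y))
         refl (δ i j) (δ j i) ⟩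
  1ℚ + 1ℚ - (δ i j + δ j i) ∎
  where open ≡-Reasoning

module _ {d} {P : Predicate d} (labels : Labelling P) where
  open Labelling labels

  -- Unit vectors of distinct labels differ in two coordinates, by 1 each, hence the factor 2.
  indicator-cut : ∀ a b → sum (λ c → difference (left a) (right b) c * difference (left a) (right b) c)
    ≡ (1ℚ + 1ℚ) * indicator (P a b)
  indicator-cut a b with P a b in Pab
  ... | true = trans (sum-difference² (left a) (right b)) (cong₂ (λ x y → 1ℚ + 1ℚ - (x + y))
    (δ-off-diagonal (left a) (right b) (true⇒≢ a b Pab))
    (δ-off-diagonal (right b) (left a) (λ eq → true⇒≢ a b Pab (sym eq))))
  ... | false = trans (sum-difference² (left a) (right b)) (trans
    (cong (λ r → 1ℚ + 1ℚ - (δ (left a) r + δ r (left a))) (sym (false⇒≡ a b Pab)))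
    (cong (λ x → 1ℚ + 1ℚ - (x + x)) (δ-diagonal (left a))))

-- Sums over concatenations and over subsets

sum-++ : ∀ {k l} (xs : Vector ℚ k) (ys : Vector ℚ l) (zs : Vector ℚ k) (ws : Vector ℚ l) →
  sum (λ i → (xs ++ ys) i * (zs ++ ws) i) ≡ sum (λ i → xs i * zs i) + sum (λ j → ys j * ws j)
sum-++ {zero}  xs ys zs ws = sym (+-identityˡ (sum (λ j → ys j * ws j)))
sum-++ {suc k} xs ys zs ws = trans
  (cong (xs zero * zs zero +_) (trans
    (sum-cong-≗ λ i → cong₂ _*_ ([,]-map (splitAt k i)) ([,]-map (splitAt k i)))
    (sum-++ (λ i → xs (suc i)) ys (λ i → zs (suc i)) ws)))
  (sym (+-assoc (xs zero * zs zero) (sum (λ i → xs (suc i) * zs (suc i))) (sum (λ j → ys j * ws j))))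

enumerate : ∀ {m} (χ : Subset m) → Fin ∣ χ ∣ → Fin m
enumerate (true  ∷ χ) zero    = zero
enumerate (true  ∷ χ) (suc j) = suc (enumerate χ j)
enumerate (false ∷ χ) j       = suc (enumerate χ j)

enumerate∈ : ∀ {m} (χ : Subset m) j → enumerate χ j ∈ χ
enumerate∈ (true  ∷ χ) zero    = here
enumerate∈ (true  ∷ χ) (suc j) = there (enumerate∈ χ j)
enumerate∈ (false ∷ χ) j       = there (enumerate∈ χ j)

enumerate-injective : ∀ {m} (χ : Subset m) {i j} → enumerate χ i ≡ enumerate χ j → i ≡ j
enumerate-injective (true  ∷ χ) {zero}  {zero}  eq = refl
enumerate-injective (true  ∷ χ) {suc i} {suc j} eq = cong suc (enumerate-injective χ (Finₚ.suc-injective eq))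
enumerate-injective (false ∷ χ) eq = enumerate-injective χ (Finₚ.suc-injective eq)

sum-enumerate : ∀ {m} (χ : Subset m) (h : Vector ℚ m) → (∀ {e} → e ∉ χ → h e ≡ 0ℚ) →
  sum (λ j → h (enumerate χ j)) ≡ sum h
sum-enumerate []          h h≡0 = refl
sum-enumerate (true  ∷ χ) h h≡0 = cong (h zero +_)
  (sum-enumerate χ (λ e → h (suc e)) (λ e∉χ → h≡0 (λ e∈ → e∉χ (drop-there e∈))))
sum-enumerate (false ∷ χ) h h≡0 = trans
  (sum-enumerate χ (λ e → h (suc e)) (λ e∉χ → h≡0 (λ e∈ → e∉χ (drop-there e∈))))
  (trans (sym (+-identityˡ (sum (λ e → h (suc e))))) (cong (_+ sum (λ e → h (suc e))) (sym (h≡0 λ ()))))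

-- Archimedean property and rational approximation of reals

ι≡/1 : ∀ n → ι n ≡ ℤ.+ n / 1
ι≡/1 zero    = refl
ι≡/1 (suc n) = begin
  ι n + 1ℚ        ≡⟨ cong (_+ 1ℚ) (trans (ι≡/1 n) (↥p/↧p≡p n/1)) ⟩
  n/1 + 1ℚ        ≡⟨ cong (_/ 1) (trans (cong (ℤ._+ ℤ.+ 1) (ℤₚ.*-identityʳ (ℤ.+ n))) (cong ℤ.+_ (ℕₚ.+-comm n 1))) ⟩
  ℤ.+ suc n / 1     ∎
  where
  open ≡-Reasoning
  n/1 : ℚ
  n/1 = mkℚ (ℤ.+ n) 0 (coprime-sym (1-coprimeTo n))

-- A nonnegative fraction is at most its numerator.
archimedean : ∀ r → ∃ λ K → r ≤ ι K
archimedean r@(mkℚ (ℤ.+ a) d c) = a , subst (r ≤_) (sym (trans (ι≡/1 a) (↥p/↧p≡p a/1)))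
  (*≤* (ℤₚ.*-monoˡ-≤-nonNeg (ℤ.+ a) (ℤ.+≤+ (ℕ.s≤s ℕ.z≤n))))
  where
  a/1 : ℚ
  a/1 = mkℚ (ℤ.+ a) 0 (coprime-sym (1-coprimeTo a))
archimedean r@(mkℚ ℤ.-[1+ a ] d c) = 0 , *≤* ℤ.-≤+

-- The search descends from an Archimedean bound while the multiple still reaches `r`. The upper
-- estimate is what keeps the number of edges of order ε⁻².
archimedean-tight : ∀ {x r} → 0ℚ < x → 0ℚ ≤ r → ∃ λ k → r ≤ ι k * x × ι k * x ≤ r + x
archimedean-tight {x} {r} x>0 r≥0 = search K (begin
  r                ≡⟨ *-identityʳ r ⟨
  r * 1ℚ           ≡⟨ cong (r *_) xy≡1 ⟨
  r * (x * y)      ≡⟨ solve 3 (λ r x y → r :* (x :* y) := x :* (r :* y)) refl r x y ⟩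
  x * (r * y)      ≤⟨ *-monoˡ-≤ (<⇒≤ x>0) (proj₂ (archimedean (r * y))) ⟩
  x * ι K          ≡⟨ *-comm x (ι K) ⟩
  ι K * x          ∎)
  where
  open ≤-Reasoning
  y : ℚ
  y = proj₁ (reciprocal x>0)
  xy≡1 : x * y ≡ 1ℚ
  xy≡1 = proj₂ (proj₂ (reciprocal x>0))
  K : ℕ
  K = proj₁ (archimedean (r * y))
  search : ∀ K → r ≤ ι K * x → ∃ λ k → r ≤ ι k * x × ι k * x ≤ r + x
  search zero    r≤ = 0 , r≤ , ≤-trans (≤-reflexive (*-zeroˡ x)) (0≤+ r≥0 (<⇒≤ x>0))
  search (suc K) r≤ with r ≤? ι K * x
  ... | yes r≤Kx = search K r≤Kx
  ... | no r≰Kx = suc K , r≤ , ≤-by (r - ι K * x) (0≤b-a (<⇒≤ (≰⇒> r≰Kx)))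
    (solve 3 (λ k x r → (k :+ con 1ℚ) :* x :+ (r :- k :* x) := r :+ x) refl (ι K) x r)

p≤∣p∣ : ∀ p → p ≤ ∣ p ∣ℚ
p≤∣p∣ p with ≤-total 0ℚ p
... | inj₁ p≥0 = ≤-reflexive (sym (0≤p⇒∣p∣≡p p≥0))
... | inj₂ p≤0 = ≤-trans p≤0 (0≤∣p∣ p)

RelativelyClose : ℚ → ℝ → ℚ → ℕ → Set
RelativelyClose γ x x̃ N = ∀ n → N ℕ.≤ n → (1ℚ - γ) * x̃ ≤ approx x n × approx x n ≤ (1ℚ + γ) * x̃

-- Positivity of x supplies q > 0 below all late terms, so the absolute tolerance γ q of the Cauchy
-- property is also a relative tolerance γ.
relativeApproximation : ∀ {γ x} → 0ℚ < γ → 0ℝ <ℝ x → ∃ λ x̃ → ∃ λ N → 0ℚ < x̃ × RelativelyClose γ x x̃ N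
relativeApproximation {γ} {x} γ>0 (q , q>0 , N₁ , h₁) = approx x N , N , x̃>0 , λ n N≤n →
  ≤-by _ (0≤b-a (≤-trans (p≤∣p∣ (approx x N - approx x n)) (<⇒≤ (close N n ℕₚ.≤-refl N≤n))))
    (solve 3 (λ g x y → (con 1ℚ :- g) :* x :+ (g :* x :- (x :- y)) := y) refl γ (approx x N) (approx x n)) ,
  ≤-by _ (0≤b-a (≤-trans (p≤∣p∣ (approx x n - approx x N)) (<⇒≤ (close n N N≤n ℕₚ.≤-refl))))
    (solve 3 (λ g x y → y :+ (g :* x :- (y :- x)) := (con 1ℚ :+ g) :* x) refl γ (approx x N) (approx x n))
  where
  regular : ∃ λ N₂ → ∀ m n → N₂ ℕ.≤ m → N₂ ℕ.≤ n → ∣ approx x m - approx x n ∣ℚ < γ * q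
  regular = cauchy x (γ * q) (0<* γ>0 q>0)
  N : ℕ
  N = N₁ ℕ.⊔ proj₁ regular
  q≤x̃ : q ≤ approx x N
  q≤x̃ = ≤-trans (≤-reflexive (sym (+-identityˡ q))) (h₁ N (ℕₚ.m≤m⊔n N₁ (proj₁ regular)))
  x̃>0 : 0ℚ < approx x N
  x̃>0 = <-≤-trans q>0 q≤x̃
  close : ∀ m n → N ℕ.≤ m → N ℕ.≤ n → ∣ approx x m - approx x n ∣ℚ < γ * approx x N
  close m n N≤m N≤n = <-≤-trans
    (proj₂ regular m n (ℕₚ.≤-trans (ℕₚ.m≤n⊔m N₁ (proj₁ regular)) N≤m) (ℕₚ.≤-trans (ℕₚ.m≤n⊔m N₁ (proj₁ regular)) N≤n))
    (*-monoˡ-≤ (<⇒≤ γ>0) q≤x̃)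

upperBound : ∀ {m} (N : Fin m → ℕ) → ∃ λ M → ∀ e → N e ℕ.≤ M
upperBound {zero}  N = 0 , λ ()
upperBound {suc m} N with M , N≤M ← upperBound (λ e → N (suc e)) =
  N zero ℕ.⊔ M , λ { zero → ℕₚ.m≤m⊔n (N zero) M ; (suc e) → ℕₚ.≤-trans (N≤M e) (ℕₚ.m≤n⊔m (N zero) M) }

approx-sum : ∀ {m} (f : Vector ℝ m) n → approx (sumℝ f) n ≡ sum (λ i → approx (f i) n)
approx-sum {zero}  f n = refl
approx-sum {suc m} f n = cong (approx (f zero) n +_) (approx-sum (λ i → f (suc i)) n)

satisfied : ∀ {n d} (I : Instance n d) → (Fin n → Fin d) → Fin (size I) → ℚ
satisfied I A i = indicator (pred (constraint I i) (A (u (constraint I i))) (A (v (constraint I i))))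

approx-⟦⟧ : ∀ b n → approx ⟦ b ⟧ n ≡ indicator b
approx-⟦⟧ true  n = refl
approx-⟦⟧ false n = refl

approx-Val : ∀ {n d} (I : Instance n d) A t →
  approx (Val I A) t ≡ sum (λ i → approx (weight I i) t * satisfied I A i)
approx-Val I A t = trans
  (approx-sum (λ i → weight I i *ℝ ⟦ pred (constraint I i) (A (u (constraint I i))) (A (v (constraint I i))) ⟧) t)
  (sum-cong-≗ λ i → cong (approx (weight I i) t *_)
    (approx-⟦⟧ (pred (constraint I i) (A (u (constraint I i))) (A (v (constraint I i)))) t))

-- Instances, cuts and sparsifiers

module _ {n d} {P : Predicate d} (labels : Labelling P) (I : Instance n d) (I∈CSP : InCSP P I) where
  open Labelling labels

  private
    m : ℕ
    m = size I
    uᵢ vᵢ : Fin m → Fin n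
    uᵢ e = u (constraint I e)
    vᵢ e = v (constraint I e)

  -- Incidence vectors of the bipartite double cover of the constraint graph:
  -- the variables indexed by the left summand occur as first arguments, those
  -- indexed by the right summand as second arguments.
  incidence : Fin (n ℕ.+ n) → Vector ℚ m
  incidence i e = (δ (uᵢ e) ++ λ j → - δ (vᵢ e) j) i

  incidence≢0 : ∀ e → incidence (uᵢ e ↑ˡ n) e ≢ 0ℚ
  incidence≢0 e eq rewrite Finₚ.splitAt-↑ˡ n (uᵢ e) n = 1≢0 (trans (sym (δ-diagonal (uᵢ e))) eq)

  cut : (Fin n → Fin d) → Fin (2 ℕ.+ d) → Vector ℚ m
  cut A c e = difference (left (A (uᵢ e))) (right (A (vᵢ e))) c

  -- The coefficients are the indicators of label `c` on the two sides of the double cover; the sign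
  -- of the second side sits in the incidence vectors.
  cut-spanned : ∀ A c → ∃ λ x → cut A c ≗ (λ e → sum λ i → x i * incidence i e)
  cut-spanned A c = X ++ Y , λ e → sym (begin
    sum (λ i → (X ++ Y) i * incidence i e)
      ≡⟨ sum-++ X Y (δ (uᵢ e)) (λ j → - δ (vᵢ e) j) ⟩
    sum (λ i → X i * δ (uᵢ e) i) + sum (λ j → Y j * - δ (vᵢ e) j)
      ≡⟨ cong₂ _+_
           (trans (sum-cong-≗ λ i → *-comm (X i) (δ (uᵢ e) i)) (sum-δ (uᵢ e) X))
           (trans (sum-cong-≗ λ j → solve 2 (λ y d → y :* :- d := d :* :- y) refl (Y j) (δ (vᵢ e) j))
             (sum-δ (vᵢ e) (λ j → - Y j))) ⟩
    X (uᵢ e) + - Y (vᵢ e) ∎)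
    where
    open ≡-Reasoning
    X Y : Vector ℚ n
    X i = δ (left (A i)) c
    Y j = δ (right (A j)) c

  sum-cuts : ∀ A (σ : Vector ℚ m) → sum (λ c → B σ (cut A c) (cut A c)) ≡ (1ℚ + 1ℚ) * sum (λ e → σ e * satisfied I A e)
  sum-cuts A σ = begin
    sum (λ c → sum (λ e → σ e * (cut A c e * cut A c e)))
      ≡⟨ ∑-comm (λ c e → σ e * (cut A c e * cut A c e)) ⟩
    sum (λ e → sum (λ c → σ e * (cut A c e * cut A c e)))
      ≡⟨ sum-cong-≗ (λ e → trans (sym (*-distribˡ-sum (σ e) (λ c → cut A c e * cut A c e)))
           (trans (cong (σ e *_) (trans (indicator-cut labels (A (uᵢ e)) (A (vᵢ e)))
              (cong (λ b → (1ℚ + 1ℚ) * indicator b) (sym (I∈CSP e (A (uᵢ e)) (A (vᵢ e)))))))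
            (solve 3 (λ s t b → s :* (t :* b) := t :* (s :* b)) refl (σ e) (1ℚ + 1ℚ) (satisfied I A e)))) ⟩
    sum (λ e → (1ℚ + 1ℚ) * (σ e * satisfied I A e))
      ≡⟨ *-distribˡ-sum (1ℚ + 1ℚ) (λ e → σ e * satisfied I A e) ⟨
    (1ℚ + 1ℚ) * sum (λ e → σ e * satisfied I A e) ∎
    where open ≡-Reasoning

  -- Summing the comparison over all labels turns cut values into twice the values of the
  -- assignment, and the factor 2 cancels.
  cuts-mono : ∀ A a (σ : Vector ℚ m) b (τ : Vector ℚ m) →
    (∀ c → a * B σ (cut A c) (cut A c) ≤ b * B τ (cut A c) (cut A c)) →
    a * sum (λ e → σ e * satisfied I A e) ≤ b * sum (λ e → τ e * satisfied I A e)
  cuts-mono A a σ b τ σ≤τ = *-cancelˡ-≤ (positive⁻¹ (1ℚ + 1ℚ)) (begin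
    (1ℚ + 1ℚ) * (a * sum (λ e → σ e * satisfied I A e))
      ≡⟨ total a σ ⟨
    sum (λ c → a * B σ (cut A c) (cut A c))
      ≤⟨ sum-mono σ≤τ ⟩
    sum (λ c → b * B τ (cut A c) (cut A c))
      ≡⟨ total b τ ⟩
    (1ℚ + 1ℚ) * (b * sum (λ e → τ e * satisfied I A e)) ∎)
    where
    open ≤-Reasoning
    total : ∀ a σ → sum (λ c → a * B σ (cut A c) (cut A c)) ≡ (1ℚ + 1ℚ) * (a * sum (λ e → σ e * satisfied I A e))
    total a σ = trans (sym (*-distribˡ-sum a (λ c → B σ (cut A c) (cut A c)))) (trans (cong (a *_) (sum-cuts A σ))
      (solve 3 (λ a t x → a :* (t :* x) := t :* (a :* x)) refl a (1ℚ + 1ℚ) (sum (λ e → σ e * satisfied I A e))))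

restrict : ∀ {n d} (I : Instance n d) {χ : Subset (size I)} {σ} → IsSupport χ σ → Instance n d
restrict I {χ} {σ} support = record
  { size = ∣ χ ∣
  ; constraint = λ j → constraint I (enumerate χ j)
  ; distinct = λ eq → enumerate-injective χ (distinct I eq)
  ; weight = λ j → fromℚ (σ (enumerate χ j))
  ; weight>0 = λ j → σ (enumerate χ j) , IsSupport.inside>0 support (enumerate∈ χ j) , 0 ,
      λ _ _ → ≤-reflexive (+-identityˡ (σ (enumerate χ j))) }

restrict-⊆ : ∀ {n d} (I : Instance n d) {χ : Subset (size I)} {σ} (support : IsSupport χ σ) → restrict I support ⊆ I
restrict-⊆ I {χ} support j = enumerate χ j , refl , refl , λ _ _ → refl

approx-Val-restrict : ∀ {n d} (I : Instance n d) {χ : Subset (size I)} {σ} (support : IsSupport χ σ) A t →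
  approx (Val (restrict I support) A) t ≡ sum (λ e → σ e * satisfied I A e)
approx-Val-restrict I {χ} {σ} support A t = trans (approx-Val (restrict I support) A t)
  (sum-enumerate χ (λ e → σ e * satisfied I A e) (λ {e} e∉χ →
    trans (cong (_* satisfied I A e) (IsSupport.outside≡0 support e∉χ)) (*-zeroˡ (satisfied I A e))))

-- Error budget, size bound and choice of precision

sum-relative : ∀ {m γ} {w w̃ s : Vector ℚ m} → (∀ e → 0ℚ ≤ s e) → (∀ e → (1ℚ - γ) * w̃ e ≤ w e × w e ≤ (1ℚ + γ) * w̃ e) →
  (1ℚ - γ) * sum (λ e → w̃ e * s e) ≤ sum (λ e → w e * s e) × sum (λ e → w e * s e) ≤ (1ℚ + γ) * sum (λ e → w̃ e * s e)
sum-relative {γ = γ} {w} {w̃} {s} s≥0 close =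
  ≤-trans (≤-reflexive (scaled (1ℚ - γ))) (sum-mono λ e → *-monoʳ-≤-nonNeg (s e) {{nonNegative (s≥0 e)}} (proj₁ (close e))) ,
  ≤-trans (sum-mono λ e → *-monoʳ-≤-nonNeg (s e) {{nonNegative (s≥0 e)}} (proj₂ (close e))) (≤-reflexive (sym (scaled (1ℚ + γ))))
  where
  scaled : ∀ a → a * sum (λ e → w̃ e * s e) ≡ sum (λ e → a * w̃ e * s e)
  scaled a = trans (*-distribˡ-sum a (λ e → w̃ e * s e)) (sum-cong-≗ λ e → sym (*-assoc a (w̃ e) (s e)))

module _ {κ e V Ṽ S : ℚ} (κ≥0 : 0ℚ ≤ κ) (12κ≤e : ι 12 * κ ≤ e) (e≤1 : e ≤ 1ℚ) (Ṽ≥0 : 0ℚ ≤ Ṽ) where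
  open ≤-Reasoning

  private
    e≥0 : 0ℚ ≤ e
    e≥0 = ≤-trans (0≤* (ι≥0 12) κ≥0) 12κ≤e

  combine-lower : V ≤ (1ℚ + κ) * Ṽ → (1ℚ - κ) * Ṽ ≤ S → (1ℚ - e) * V ≤ S
  combine-lower V≤ ≤S = begin
    (1ℚ - e) * V                ≤⟨ *-monoˡ-≤ (0≤b-a e≤1) V≤ ⟩
    (1ℚ - e) * ((1ℚ + κ) * Ṽ)   ≤⟨ ≤-by (((e - ι 12 * κ) + e * κ + ι 10 * κ) * Ṽ)
      (0≤* (0≤+ (0≤+ (0≤b-a 12κ≤e) (0≤* e≥0 κ≥0)) (0≤* (ι≥0 10) κ≥0)) Ṽ≥0)
      (solve 3 (λ e k v → (con 1ℚ :- e) :* ((con 1ℚ :+ k) :* v) :+ ((e :- con (ι 12) :* k) :+ e :* k :+ con (ι 10) :* k) :* v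
         := (con 1ℚ :- k) :* v) refl e κ Ṽ) ⟩
    (1ℚ - κ) * Ṽ                ≤⟨ ≤S ⟩
    S                           ∎

  -- The sparsifier costs 7κ and the rational weights cost κ: the slack (1 + e)(1 - κ) - (1 + 7κ) =
  -- e - 8κ - eκ is at least 3κ.
  combine-upper : (1ℚ - κ) * Ṽ ≤ V → S ≤ (1ℚ + ι 7 * κ) * Ṽ → S ≤ (1ℚ + e) * V
  combine-upper ≤V S≤ = begin
    S                           ≤⟨ S≤ ⟩
    (1ℚ + ι 7 * κ) * Ṽ          ≤⟨ ≤-by (((e - ι 12 * κ) + ι 3 * κ + κ * (1ℚ - e)) * Ṽ)
      (0≤* (0≤+ (0≤+ (0≤b-a 12κ≤e) (0≤* (ι≥0 3) κ≥0)) (0≤* κ≥0 (0≤b-a e≤1))) Ṽ≥0)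
      (solve 3 (λ e k v → (con 1ℚ :+ con (ι 7) :* k) :* v :+ ((e :- con (ι 12) :* k) :+ con (ι 3) :* k :+ k :* (con 1ℚ :- e)) :* v
         := (con 1ℚ :+ e) :* ((con 1ℚ :- k) :* v)) refl e κ Ṽ) ⟩
    (1ℚ + e) * ((1ℚ - κ) * Ṽ)   ≤⟨ *-monoˡ-≤ (0≤+ (<⇒≤ (positive⁻¹ 1ℚ)) e≥0) ≤V ⟩
    (1ℚ + e) * V                ∎

-- The step count 2n k² becomes 2n (k e)² after multiplication by e², and k e is bounded by the
-- constant `C`.
size-bound : ∀ {s n k e} C → s ℕ.≤ (n ℕ.+ n) ℕ.* (k ℕ.* k) → 0ℚ ≤ e → ι k * e ≤ ι C →
  ι s * (e * e) ≤ ι (2 ℕ.* (C ℕ.* C)) * ι n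
size-bound {s} {n} {k} {e} C s≤ e≥0 ke≤C = begin
  ι s * (e * e)
    ≤⟨ *-monoʳ-≤-nonNeg (e * e) {{nonNegative (0≤a² e)}} (ι-mono s≤) ⟩
  ι ((n ℕ.+ n) ℕ.* (k ℕ.* k)) * (e * e)
    ≡⟨ cong (_* (e * e)) (trans (ι-* (n ℕ.+ n) (k ℕ.* k)) (cong₂ _*_ (ι-+ n n) (ι-* k k))) ⟩
  (ι n + ι n) * (ι k * ι k) * (e * e)
    ≡⟨ solve 3 (λ n k e → (n :+ n) :* (k :* k) :* (e :* e) := (n :+ n) :* ((k :* e) :* (k :* e))) refl (ι n) (ι k) e ⟩
  (ι n + ι n) * ((ι k * e) * (ι k * e))
    ≤⟨ *-monoˡ-≤ (0≤+ (ι≥0 n) (ι≥0 n)) (≤-trans (*-monoˡ-≤ (0≤* (ι≥0 k) e≥0) ke≤C)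
         (*-monoʳ-≤-nonNeg (ι C) {{nonNegative (ι≥0 C)}} ke≤C)) ⟩
  (ι n + ι n) * (ι C * ι C)
    ≡⟨ solve 2 (λ n c → (n :+ n) :* (c :* c) := con (ι 2) :* (c :* c) :* n) refl (ι n) (ι C) ⟩
  ι 2 * (ι C * ι C) * ι n
    ≡⟨ cong (_* ι n) (trans (ι-* 2 (C ℕ.* C)) (cong (ι 2 *_) (ι-* C C))) ⟨
  ι (2 ℕ.* (C ℕ.* C)) * ι n ∎
  where open ≤-Reasoning

-- k is chosen with 12 ≤ k ε̃ ≤ 13 for a rational ε̃ with ε̃ ≤ ε ≤ 2ε̃.
record Precision (ε : ℝ) : Set where
  field
    k     : ℕ
    k≥12  : ι 12 ≤ ι k
    κ     : ℚ
    κ>0   : 0ℚ < κ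
    kκ≡1  : ι k * κ ≡ 1ℚ
    N     : ℕ
    12κ≤ε : ∀ {t} → N ℕ.≤ t → ι 12 * κ ≤ approx ε t
    ε≤1   : ∀ {t} → N ℕ.≤ t → approx ε t ≤ 1ℚ
    kε≤26 : ∀ {t} → N ℕ.≤ t → ι k * approx ε t ≤ ι 26

precision : ∀ {ε} → 0ℝ <ℝ ε → ε <ℝ 1ℝ → Precision ε
precision {ε} ε>0 (q , q>0 , N₂ , ε+q≤1) = record
  { k = k ; k≥12 = k≥12 ; κ = κ ; κ>0 = κ>0 ; kκ≡1 = kκ≡1 ; N = N
  ; 12κ≤ε = λ N≤t → ≤-trans 12κ≤ε̃ (ε̃≤ε N≤t)
  ; ε≤1 = ε≤1
  ; kε≤26 = λ {t} N≤t → begin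
      ι k * approx ε t          ≤⟨ *-monoˡ-≤ (ι≥0 k) (ε≤2ε̃ N≤t) ⟩
      ι k * (ι 2 * ε̃)           ≡⟨ solve 2 (λ k e → k :* (con (ι 2) :* e) := con (ι 2) :* (k :* e)) refl (ι k) ε̃ ⟩
      ι 2 * (ι k * ε̃)           ≤⟨ *-monoˡ-≤ (ι≥0 2) (≤-trans kε̃≤ (+-monoʳ-≤ (ι 12) ε̃≤1)) ⟩
      ι 2 * (ι 12 + 1ℚ)         ≡⟨⟩
      ι 26                      ∎ }
  where
  open ≤-Reasoning
  ⅓ ⅔ : ℚ
  ⅓ = ℤ.+ 1 / 3
  ⅔ = ℤ.+ 2 / 3
  approximation : ∃ λ x̃ → ∃ λ N → 0ℚ < x̃ × RelativelyClose ⅓ ε x̃ N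
  approximation = relativeApproximation {x = ε} (positive⁻¹ ⅓) ε>0
  -- Tolerance 1/3 puts ε between 2/3 and 4/3 of `x̃`, two bounds of ratio 2; `ε̃` is the smaller
  -- one.
  x̃ ε̃ : ℚ
  x̃ = proj₁ approximation
  ε̃ = ⅔ * x̃
  N₁ N : ℕ
  N₁ = proj₁ (proj₂ approximation)
  N = N₁ ℕ.⊔ N₂
  ε̃>0 : 0ℚ < ε̃
  ε̃>0 = 0<* (positive⁻¹ ⅔) (proj₁ (proj₂ (proj₂ approximation)))
  close : ∀ {t} → N ℕ.≤ t → (1ℚ - ⅓) * x̃ ≤ approx ε t × approx ε t ≤ (1ℚ + ⅓) * x̃
  close {t} N≤t = proj₂ (proj₂ (proj₂ approximation)) t (ℕₚ.≤-trans (ℕₚ.m≤m⊔n N₁ N₂) N≤t)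
  ε̃≤ε : ∀ {t} → N ℕ.≤ t → ε̃ ≤ approx ε t
  ε̃≤ε N≤t = proj₁ (close N≤t)
  ε≤2ε̃ : ∀ {t} → N ℕ.≤ t → approx ε t ≤ ι 2 * ε̃
  ε≤2ε̃ N≤t = ≤-trans (proj₂ (close N≤t)) (≤-reflexive
    (solve 1 (λ x → (con 1ℚ :+ con ⅓) :* x := con (ι 2) :* (con ⅔ :* x)) refl x̃))
  ε≤1 : ∀ {t} → N ℕ.≤ t → approx ε t ≤ 1ℚ
  ε≤1 {t} N≤t = ≤-trans (≤-by q (<⇒≤ q>0) refl) (ε+q≤1 t (ℕₚ.≤-trans (ℕₚ.m≤n⊔m N₁ N₂) N≤t))
  ε̃≤1 : ε̃ ≤ 1ℚ
  ε̃≤1 = ≤-trans (ε̃≤ε ℕₚ.≤-refl) (ε≤1 ℕₚ.≤-refl)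
  multiple : ∃ λ k → ι 12 ≤ ι k * ε̃ × ι k * ε̃ ≤ ι 12 + ε̃
  multiple = archimedean-tight ε̃>0 (ι≥0 12)
  k : ℕ
  k = proj₁ multiple
  kε̃≥ : ι 12 ≤ ι k * ε̃
  kε̃≥ = proj₁ (proj₂ multiple)
  kε̃≤ : ι k * ε̃ ≤ ι 12 + ε̃
  kε̃≤ = proj₂ (proj₂ multiple)
  k≥12 : ι 12 ≤ ι k
  k≥12 = ≤-trans kε̃≥ (≤-trans (*-monoˡ-≤ (ι≥0 k) ε̃≤1) (≤-reflexive (*-identityʳ (ι k))))
  k>0 : 0ℚ < ι k
  k>0 = <-≤-trans (positive⁻¹ (ι 12)) k≥12
  κ : ℚ
  κ = proj₁ (reciprocal k>0)
  κ>0 : 0ℚ < κ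
  κ>0 = proj₁ (proj₂ (reciprocal k>0))
  kκ≡1 : ι k * κ ≡ 1ℚ
  kκ≡1 = proj₂ (proj₂ (reciprocal k>0))
  12κ≤ε̃ : ι 12 * κ ≤ ε̃
  12κ≤ε̃ = begin
    ι 12 * κ           ≤⟨ *-monoʳ-≤-nonNeg κ {{nonNegative (<⇒≤ κ>0)}} kε̃≥ ⟩
    ι k * ε̃ * κ        ≡⟨ solve 3 (λ k e κ → k :* e :* κ := k :* κ :* e) refl (ι k) ε̃ κ ⟩
    ι k * κ * ε̃        ≡⟨ trans (cong (_* ε̃) kκ≡1) (*-identityˡ ε̃) ⟩
    ε̃                  ∎

-- The barrier argument needs a nonzero vector in W, hence an edge. Without constraints all values
-- are empty sums, and the empty subset serves.
edge? : ∀ m → Fin m ⊎ (∀ (f : Vector ℚ m) → sum f ≡ 0ℚ)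
edge? zero    = inj₂ λ _ → refl
edge? (suc m) = inj₁ zero

record ReweightedSubset {n d} (I : Instance n d) (w : Vector ℚ (size I)) (κ : ℚ) (T : ℕ) : Set where
  field
    {σ}     : Vector ℚ (size I)
    {χ}     : Subset (size I)
    ∣χ∣≤    : ∣ χ ∣ ℕ.≤ T
    support : IsSupport χ σ
    lower   : ∀ A → (1ℚ - κ) * sum (λ e → w e * satisfied I A e) ≤ sum (λ e → σ e * satisfied I A e)
    upper   : ∀ A → sum (λ e → σ e * satisfied I A e) ≤ (1ℚ + ι 7 * κ) * sum (λ e → w e * satisfied I A e)

sparsifyRational : ∀ {n d} {P : Predicate d} → Labelling P → (I : Instance n d) → InCSP P I →
  ∀ {w} → (∀ e → 0ℚ < w e) → ∀ {k} → ι 12 ≤ ι k → ∀ {κ} → 0ℚ < κ → ι k * κ ≡ 1ℚ →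
  ReweightedSubset I w κ ((n ℕ.+ n) ℕ.* (k ℕ.* k))
sparsifyRational {n} {d} labels I I∈CSP {w} w>0 {k} k≥12 {κ} κ>0 kκ≡1 with edge? (size I)
... | inj₁ e₀ = record
  { ∣χ∣≤ = S.∣χ∣≤
  ; support = S.support
  ; lower = λ A → ≤-trans
      (cuts-mono labels I I∈CSP A (1ℚ - κ) w 1ℚ S.σ λ c → ≤-trans (S.lower (cut-spanned labels I I∈CSP A c))
        (≤-reflexive (sym (*-identityˡ _))))
      (≤-reflexive (*-identityˡ _))
  ; upper = λ A → ≤-trans (≤-reflexive (sym (*-identityˡ _)))
      (cuts-mono labels I I∈CSP A 1ℚ S.σ (1ℚ + ι 7 * κ) w λ c → ≤-trans (≤-reflexive (*-identityˡ _))
        (S.upper (cut-spanned labels I I∈CSP A c))) }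
  where
  module S = Sparsified (spectralSparsifier w>0 (incidence labels I I∈CSP) {e₀ = e₀}
    (incidence≢0 labels I I∈CSP e₀) {k = k} k≥12 κ>0 kκ≡1)
... | inj₂ empty = record
  { χ = ⊥
  ; ∣χ∣≤ = ℕₚ.≤-trans (ℕₚ.≤-reflexive (∣⊥∣≡0 (size I))) ℕ.z≤n
  ; support = record { inside>0 = λ e∈⊥ → contradiction e∈⊥ ∉⊥ ; outside≡0 = λ _ → refl }
  ; lower = λ A → ≤-reflexive (trans (cong ((1ℚ - κ) *_) (empty (λ e → w e * satisfied I A e)))
      (trans (*-zeroʳ (1ℚ - κ)) (sym (empty (λ e → 0ℚ * satisfied I A e)))))
  ; upper = λ A → ≤-reflexive (trans (empty (λ e → 0ℚ * satisfied I A e))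
      (sym (trans (cong ((1ℚ + ι 7 * κ) *_) (empty (λ e → w e * satisfied I A e))) (*-zeroʳ (1ℚ + ι 7 * κ))))) }

private
  ≤ℝ-eventually : ∀ {x y} N → (∀ t → N ℕ.≤ t → approx x t ≤ approx y t) → x ≤ℝ y
  ≤ℝ-eventually N x≤y q q>0 = N , λ t N≤t → ≤-trans (x≤y t N≤t) (≤-by q (<⇒≤ q>0) refl)

-- The new instance is built from rational weights `w̃` with relative error κ. Beyond a common index
-- `N`, which exists because there are finitely many weights, each of the three real inequalities
-- holds termwise as an inequality in ℚ.
sparsify : ∀ {d} {P : Predicate d} → Labelling P → ∀ ε → 0ℝ <ℝ ε → ε <ℝ 1ℝ → ∀ n (I : Instance n d) → InCSP P I →
  ∃[ J ] (IsSparsifier ε I J × fromℕ (size J) *ℝ (ε *ℝ ε) ≤ℝ fromℕ (2 ℕ.* (26 ℕ.* 26)) *ℝ fromℕ n)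
sparsify labels ε ε>0 ε<1 n I I∈CSP = J , record
  { subset = restrict-⊆ I R.support
  ; lower = λ A → ≤ℝ-eventually {(1ℝ -ℝ ε) *ℝ Val I A} {Val J A} N λ t N≤t →
      subst₂ (λ V S → (1ℚ - approx ε t) * V ≤ S)
        (sym (approx-Val I A t)) (sym (approx-Val-restrict I R.support A t))
        (combine-lower κ≥0 (12κ≤ε (Nε≤ N≤t)) (ε≤1 (Nε≤ N≤t)) (Ṽ≥0 A) (proj₂ (V-close A N≤t)) (R.lower A))
  ; upper = λ A → ≤ℝ-eventually {Val J A} {(1ℝ +ℝ ε) *ℝ Val I A} N λ t N≤t →
      subst₂ (λ V S → S ≤ (1ℚ + approx ε t) * V)
        (sym (approx-Val I A t)) (sym (approx-Val-restrict I R.support A t))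
        (combine-upper κ≥0 (12κ≤ε (Nε≤ N≤t)) (ε≤1 (Nε≤ N≤t)) (Ṽ≥0 A) (proj₁ (V-close A N≤t)) (R.upper A))
  } , ≤ℝ-eventually {fromℕ (size J) *ℝ (ε *ℝ ε)} {fromℕ (2 ℕ.* (26 ℕ.* 26)) *ℝ fromℕ n} N λ t N≤t →
      subst₂ _≤_ (cong (_* (approx ε t * approx ε t)) (ι≡/1 (size J)))
        (cong₂ _*_ (ι≡/1 (2 ℕ.* (26 ℕ.* 26))) (ι≡/1 n))
        (size-bound {n = n} {k} 26 R.∣χ∣≤ (≤-trans (0≤* (ι≥0 12) κ≥0) (12κ≤ε (Nε≤ N≤t))) (kε≤26 (Nε≤ N≤t)))
  where
  open Precision (precision {ε} ε>0 ε<1) renaming (N to Nε)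
  κ≥0 : 0ℚ ≤ κ
  κ≥0 = <⇒≤ κ>0
  approximation : ∀ e → ∃ λ w̃ → ∃ λ N → 0ℚ < w̃ × RelativelyClose κ (weight I e) w̃ N
  approximation e = relativeApproximation {x = weight I e} κ>0 (weight>0 I e)
  w̃ : Vector ℚ (size I)
  w̃ e = proj₁ (approximation e)
  w̃>0 : ∀ e → 0ℚ < w̃ e
  w̃>0 e = proj₁ (proj₂ (proj₂ (approximation e)))
  M : ∃ λ M → ∀ e → proj₁ (proj₂ (approximation e)) ℕ.≤ M
  M = upperBound λ e → proj₁ (proj₂ (approximation e))
  N : ℕ
  N = Nε ℕ.⊔ proj₁ M
  Nε≤ : ∀ {t} → N ℕ.≤ t → Nε ℕ.≤ t
  Nε≤ = ℕₚ.≤-trans (ℕₚ.m≤m⊔n Nε (proj₁ M))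
  module R = ReweightedSubset (sparsifyRational labels I I∈CSP {w̃} w̃>0 {k} k≥12 κ>0 kκ≡1)
  J : Instance n _
  J = restrict I R.support
  satisfied≥0 : ∀ A e → 0ℚ ≤ satisfied I A e
  satisfied≥0 A e = indicator≥0 (pred (constraint I e) (A (u (constraint I e))) (A (v (constraint I e))))
  Ṽ≥0 : ∀ A → 0ℚ ≤ sum (λ e → w̃ e * satisfied I A e)
  Ṽ≥0 A = sum-nonneg λ e → 0≤* (<⇒≤ (w̃>0 e)) (satisfied≥0 A e)
  V-close : ∀ A {t} → N ℕ.≤ t →
    (1ℚ - κ) * sum (λ e → w̃ e * satisfied I A e) ≤ sum (λ e → approx (weight I e) t * satisfied I A e) ×
    sum (λ e → approx (weight I e) t * satisfied I A e) ≤ (1ℚ + κ) * sum (λ e → w̃ e * satisfied I A e)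
  V-close A {t} N≤t = sum-relative {γ = κ} {w̃ = w̃} (satisfied≥0 A) λ e → proj₂ (proj₂ (proj₂ (approximation e))) t
    (ℕₚ.≤-trans (ℕₚ.≤-trans (proj₂ M e) (ℕₚ.m≤n⊔m Nε (proj₁ M))) N≤t)

theorem8 : ∀ (d : ℕ) (P : Predicate d) →
    (∀ (B C : Subset d) → ∣ B ∣ ≡ 2 → ∣ C ∣ ≡ 2 → ¬ IsSingletonOn P B C) →
    ∃[ K ] (∀ (ε : ℝ) → 0ℝ <ℝ ε → ε <ℝ 1ℝ →
    ∀ (n : ℕ) (I : Instance n d) → InCSP P I →
    ∃[ J ] (IsSparsifier ε I J × fromℕ (size J) *ℝ (ε *ℝ ε) ≤ℝ fromℕ K *ℝ fromℕ n))
theorem8 d P noSingleton = 2 ℕ.* (26 ℕ.* 26) , sparsify (labelling P noSingleton)
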